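{- A graph $G$ is claw-free and chordal if and only if $G$ is an NC-path-tree graph. Moreover, such a graph $G$ has a unique clique tree, and this clique tree is an NC-path-tree model of $G$.
   Context: All graphs are finite, simple, loopless, undirected and connected. A graph is chordal if it has no induced cycle of length at least four. The claw is $K_{1,3}$; claw-free means containing no claw as an induced subgraph. A path-tree model of $G$ is a pair $(\{P_v\}_{v\in V(G)},T)$ where each $P_v$ is a path (possibly a single node), $T=\bigcup_{v\in V(G)}P_v$ is a tree, and for distinct $u,v\in V(G)$, $uv\in E(G)$ if and only if $P_u\cap P_v\neq\emptyset$ (they share a node). Two paths $P_u,P_v$ of $T$ are non-crossing if both $P_u\setminus P_v$ and $P_v\setminus P_u$ (the subgraphs of $P_u$, resp. $P_v$, obtained by deleting the nodes of the other path) are connected, where the empty set counts as connected. The model is an NC-path-tree model if the paths are pairwise non-crossing, and $G$ is an NC-path-tree graph if it has an NC-path-tree model. A clique tree of a graph $G$ is a tree $T$ whose nodes are the maximal cliques of $G$ such that for every vertex $v$ of $G$ the set of maximal cliques containing $v$ induces a subtree $T_v$ of $T$. The clique tree is regarded as the intersection model $(\{T_v\}_{v\in V(G)},T)$ of $G$. -}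

module Defs where

open import Data.Fin using (Fin; zero; toℕ)
import Data.Fin.Properties as Fin
open import Data.Fin.Subset using (Subset; _∈_; _⊆_)
open import Data.Nat using (ℕ; suc; _≤_; s≤s)
open import Data.Nat.Properties using (_≟_; <⇒≤; 1+n≢n)
open import Data.Product using (Σ; ∃; _×_; _,_)
open import Data.Refinement using (Refinement; value)
open import Data.Sum using (_⊎_; inj₁; inj₂; [_,_]′)
open import Data.Unit using (⊤)
open import Function using (_⇔_; _↔_)
open import Function.Construct.Identity using (↔-id)
open import Function.Definitions using (Injective)
open import Level using (0ℓ)
open import Relation.Binary using (Rel; Decidable; Symmetric; Irreflexive)
open import Relation.Binary.Construct.Closure.ReflexiveTransitive using (Star)
open import Relation.Binary.Construct.Closure.Symmetric using (SymClosure; fwd; bwd; symmetric)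
open import Relation.Binary.PropositionalEquality using (_≡_; _≢_; refl; sym; trans; cong)
open import Relation.Nullary using (¬_; ¬?)
open import Relation.Nullary.Decidable using (map′; _×-dec_; _⊎-dec_)
open import Relation.Unary using (Pred)

private
  variable
    n : ℕ
    V W : Set

Finite : Set → Set
Finite A = ∃ λ n → Fin n ↔ A

record Graph (V : Set) : Set₁ where
  field
    finite : Finite V
    Adj    : Rel V 0ℓ
    adj?   : Decidable Adj
    symAdj : Symmetric Adj
    irrAdj : Irreflexive _≡_ Adj

open Graph public

infix 4 _≈ᴳ_

_≈ᴳ_ : Graph V → Graph V → Set
G ≈ᴳ H = ∀ x y → Adj G x y ⇔ Adj H x y

symGraph : {R : Rel (Fin n) 0ℓ} → Decidable R → Irreflexive _≡_ R → Graph (Fin n)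
symGraph {R = R} R? irr = record
  { finite = _ , ↔-id _
  ; Adj    = SymClosure R
  ; adj?   = λ i j → map′ [ fwd , bwd ]′ (λ { (fwd r) → inj₁ r ; (bwd r) → inj₂ r })
                          (R? i j ⊎-dec R? j i)
  ; symAdj = symmetric R
  ; irrAdj = λ { eq (fwd r) → irr eq r ; eq (bwd r) → irr (sym eq) r }
  }

-- K₁,₃ with centre 0.
claw : Graph (Fin 4)
claw = symGraph {R = λ i j → i ≡ zero × j ≢ zero}
  (λ i j → (i Fin.≟ zero) ×-dec ¬? (j Fin.≟ zero))
  (λ { eq (i≡0 , j≢0) → j≢0 (trans (sym eq) i≡0) })

pathGraph : ∀ k → Graph (Fin k)
pathGraph k = symGraph {R = λ i j → suc (toℕ i) ≡ toℕ j}
  (λ i j → suc (toℕ i) ≟ toℕ j)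
  (λ { refl → 1+n≢n })

-- j follows i in the cyclic order 0, 1, …, k - 1, 0.
CyclicSuc : ∀ k → Rel (Fin k) 0ℓ
CyclicSuc k i j = (suc (toℕ i) ≡ toℕ j) ⊎ (suc (toℕ i) ≡ k × toℕ j ≡ 0)

cycleGraph : ∀ k → 3 ≤ k → Graph (Fin k)
cycleGraph k 3≤k = symGraph {R = CyclicSuc k}
  (λ i j → (suc (toℕ i) ≟ toℕ j) ⊎-dec ((suc (toℕ i) ≟ k) ×-dec (toℕ j ≟ 0)))
  (λ { refl (inj₁ e) → 1+n≢n e
     ; refl (inj₂ (e , z)) → loopless 3≤k (trans (sym e) (cong suc z)) })
  where
  loopless : ∀ {m} → 3 ≤ m → m ≢ 1
  loopless (s≤s ()) refl

InducedIn : Graph V → Graph W → Set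
InducedIn {V} {W} H G = Σ (V → W) λ f →
  Injective _≡_ _≡_ f × (∀ x y → Adj H x y ⇔ Adj G (f x) (f y))

ClawFree : Graph V → Set
ClawFree G = ¬ InducedIn claw G

Chordal : Graph V → Set
Chordal G = ∀ k (4≤k : 4 ≤ k) → ¬ InducedIn (cycleGraph k (<⇒≤ 4≤k)) G

record Subgraph (G : Graph V) : Set₁ where
  field
    node     : Pred V 0ℓ
    edge     : Rel V 0ℓ
    symEdge  : Symmetric edge
    edge⇒adj : ∀ {x y} → edge x y → Adj G x y
    source   : ∀ {x y} → edge x y → node x

open Subgraph public

private
  variable
    G T : Graph V

induced : (G : Graph V) → Pred V 0ℓ → Subgraph G
induced G P = record
  { node     = P
  ; edge     = λ x y → P x × P y × Adj G x y
  ; symEdge  = λ { (p , q , a) → q , p , symAdj G a }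
  ; edge⇒adj = λ { (_ , _ , a) → a }
  ; source   = λ { (p , _ , _) → p }
  }

whole : (G : Graph V) → Subgraph G
whole G = induced G (λ _ → ⊤)

infixl 6 _∖_

_∖_ : Subgraph G → Subgraph G → Subgraph G
P ∖ Q = record
  { node     = λ x → node P x × ¬ node Q x
  ; edge     = λ x y → edge P x y × ¬ node Q x × ¬ node Q y
  ; symEdge  = λ { (e , x∉Q , y∉Q) → symEdge P e , y∉Q , x∉Q }
  ; edge⇒adj = λ { (e , _) → edge⇒adj P e }
  ; source   = λ { (e , x∉Q , _) → source P e , x∉Q }
  }

Intersects : Subgraph G → Subgraph G → Set
Intersects P Q = ∃ λ x → node P x × node Q x

-- The empty subgraph satisfies this, but is not Connected.
EmptyOrConnected : Subgraph G → Set
EmptyOrConnected H = ∀ x y → node H x → node H y → Star (edge H) x y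

Connected : Subgraph G → Set
Connected H = ∃ (node H) × EmptyOrConnected H

Acyclic : {G : Graph V} → Subgraph G → Set
Acyclic {V} H = ∀ k (3≤k : 3 ≤ k) → ¬ (Σ (Fin k → V) λ f →
  Injective _≡_ _≡_ f × (∀ i j → Adj (cycleGraph k 3≤k) i j → edge H (f i) (f j)))

IsTree : Subgraph G → Set
IsTree H = Connected H × Acyclic H

ConnectedGraph : Graph V → Set
ConnectedGraph G = Connected (whole G)

IsTreeGraph : Graph V → Set
IsTreeGraph G = IsTree (whole G)

-- H is the image of a path graph on at least one node; a single node is allowed.
record IsPath {V} {G : Graph V} (H : Subgraph G) : Set where
  field
    length    : ℕ
    nodeAt    : Fin (suc length) → V
    injective : Injective _≡_ _≡_ nodeAt
    nodes     : ∀ x → node H x ⇔ (∃ λ i → nodeAt i ≡ x)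
    edges     : ∀ i j → edge H (nodeAt i) (nodeAt j) ⇔ Adj (pathGraph (suc length)) i j

NonCrossing : Subgraph G → Subgraph G → Set
NonCrossing P Q = EmptyOrConnected (P ∖ Q) × EmptyOrConnected (Q ∖ P)

record IsPathTreeModel (G : Graph V) (T : Graph W) (P : V → Subgraph T) : Set where
  field
    tree         : IsTreeGraph T
    paths        : ∀ v → IsPath (P v)
    nodesCovered : ∀ x → ∃ λ v → node (P v) x
    edgesCovered : ∀ x y → Adj T x y → ∃ λ v → edge (P v) x y
    adjacency    : ∀ u v → u ≢ v → Adj G u v ⇔ Intersects (P u) (P v)

IsNCPathTreeModel : (G : Graph V) (T : Graph W) → (V → Subgraph T) → Set
IsNCPathTreeModel G T P =
  IsPathTreeModel G T P × (∀ u v → u ≢ v → NonCrossing (P u) (P v))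

IsNCPathTreeGraph : Graph V → Set₁
IsNCPathTreeGraph {V} G =
  Σ Set λ W → Σ (Graph W) λ T → Σ (V → Subgraph T) λ P → IsNCPathTreeModel G T P

IsClique : Graph (Fin n) → Subset n → Set
IsClique G K = ∀ u v → u ∈ K → v ∈ K → u ≢ v → Adj G u v

IsMaximalClique : Graph (Fin n) → Subset n → Set
IsMaximalClique G K = IsClique G K × (∀ L → IsClique G L → K ⊆ L → L ≡ K)

-- The maximality proof is irrelevant, so maximal cliques are equal exactly
-- when they are equal as sets of vertices.
MaximalClique : Graph (Fin n) → Set
MaximalClique {n} G = Refinement (Subset n) (IsMaximalClique G)

cliqueSubtree : (G : Graph (Fin n)) (T : Graph (MaximalClique G)) → Fin n → Subgraph T
cliqueSubtree G T v = induced T (λ K → v ∈ value K)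

IsCliqueTree : (G : Graph (Fin n)) → Graph (MaximalClique G) → Set
IsCliqueTree G T = IsTreeGraph T × (∀ v → IsTree (cliqueSubtree G T v))

{-# OPTIONS --safe #-}
-- Everything about a tree T is drawn from one fact: no walk joins the ends of an edge
-- without using that edge (bridge).
--
-- In an NC-path-tree model, three disjoint paths meeting a path P do so at three indices
-- of P, and the middle one separates P: there is no claw. The paths of an induced cycle
-- of length at least four would lead around an edge of T: there is no hole.
--
-- Let G be claw-free and chordal. In a clique tree, a vertex of K₁ ∖ K for an edge K₁ K
-- is not adjacent to any vertex whose subtree stays on the other side. Hence a branching
-- subtree, and a crossing of two subtrees, gives a claw. By the same argument K and L are
-- adjacent in every clique tree if and only if no third maximal clique contains K ∩ L,
-- which gives uniqueness. For existence one takes this as the definition of a graph on the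
-- maximal cliques. The subtree of v is connected by induction on K ∩ L: claw-freeness at v
-- links K, L and any third clique over S = K ∩ L through edges outside S. There is no
-- cycle by chordality: on a chordless path in G - S from L ∖ S to K, the last edge is
-- completely joined to S.
module Submission where

open import Defs
open import Data.Bool using (true; false)
import Data.Bool.Properties as Bool
open import Data.Empty using (⊥; ⊥-elim; ⊥-elim-irr)
open import Data.Fin using (Fin; zero; suc; toℕ; fromℕ; inject₁; opposite)
open import Data.Fin.Induction using (<-weakInduction)
import Data.Fin.Properties as Fin
open import Data.Fin.Relation.Unary.Top using (view; ‵fromℕ; ‵inject₁)
open import Data.Fin.Subset using (Subset; _∈_; _∉_; _⊆_; _⊃_; _∪_; _∩_; ⁅_⁆; inside; outside)
open import Data.Fin.Subset.Induction using (⊃-wellFounded; Acc; acc)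
open import Data.Fin.Subset.Properties
open import Data.Irrelevant using ([_])
open import Data.Nat using (ℕ; zero; suc; _+_; _≤_; _<_; z≤n; s≤s)
import Data.Nat.Properties as ℕ
open import Data.Product using (∃; ∃!; _×_; _,_; proj₁; proj₂)
open import Data.Refinement using (Refinement; value; value-injective; _,_)
import Data.Refinement as Refinement
open import Data.Sum using (_⊎_; inj₁; inj₂; [_,_]′)
open import Data.Sum.Function.Propositional using (_⊎-↔_)
open import Data.Unit using (tt)
import Data.Vec as Vec
open import Data.Vec.Functional using (_∷_)
import Data.Vec.Properties as Vec
open import Function using (_⇔_; _∘_; Inverse; Equivalence; mk⇔; mk↔ₛ′)
open import Function.Construct.Composition using (_↔-∘_)
open import Function.Definitions using (Injective)
open import Function.Properties.Inverse using (↔⇒↣; ↔-sym)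
open import Level using (0ℓ)
open import Relation.Binary using (Rel; Decidable; DecidableEquality; Symmetric; tri<; tri≈; tri>)
open import Relation.Binary.Construct.Closure.ReflexiveTransitive as Star using (Star; ε; _◅_; _◅◅_)
open import Relation.Binary.Construct.Closure.Symmetric using (SymClosure; fwd; bwd; symmetric)
open import Relation.Binary.PropositionalEquality using (_≡_; _≢_; refl; sym; trans; cong; subst)
open import Relation.Nullary using (¬_; Dec; yes; no; contradiction)
open import Relation.Nullary.Decidable
  using (map′; _×-dec_; _⊎-dec_; _→-dec_; ¬?; recompute; decidable-stable; via-injection)
open import Relation.Unary using (Pred)

private
  variable
    n r : ℕ
    V W : Set

-- Trails and chordless paths of a relation

record IsTrail (R : Rel V 0ℓ) {r : ℕ} (p : Fin (suc r) → V) : Set where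
  field
    steps : ∀ i → R (p (inject₁ i)) (p (suc i))
    inj   : Injective _≡_ _≡_ p

open IsTrail

-- `R` may be asymmetric: later it puts different conditions on the two ends of an edge. Hence only
-- forward pairs are tested.
Chordless : Rel V 0ℓ → (Fin (suc r) → V) → Set
Chordless R p = ∀ {i j} → suc (toℕ i) < toℕ j → ¬ R (p i) (p j)

tail-trail : {R : Rel V 0ℓ} {p : Fin (suc (suc r)) → V} → IsTrail R p → IsTrail R (p ∘ suc)
tail-trail t = record { steps = steps t ∘ suc ; inj = Fin.suc-injective ∘ inj t }

cons-injective : ∀ {x} {p : Fin r → V} → (∀ i → x ≢ p i) → Injective _≡_ _≡_ p → Injective _≡_ _≡_ (x ∷ p)
cons-injective x∉p p-inj {zero}  {zero}  _ = refl
cons-injective x∉p p-inj {zero}  {suc j} e = ⊥-elim (x∉p j e)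
cons-injective x∉p p-inj {suc i} {zero}  e = ⊥-elim (x∉p i (sym e))
cons-injective x∉p p-inj {suc i} {suc j} e = cong suc (p-inj e)

cons-trail : ∀ {R : Rel V 0ℓ} {x} {p : Fin (suc r) → V} →
             R x (p zero) → (∀ i → x ≢ p i) → IsTrail R p → IsTrail R (x ∷ p)
cons-trail xRp x∉p t = record
  { steps = λ { zero → xRp ; (suc i) → steps t i }
  ; inj   = cons-injective x∉p (inj t)
  }

opposite-inject₁ : (i : Fin r) → opposite (inject₁ i) ≡ suc (opposite i)
opposite-inject₁ zero    = refl
opposite-inject₁ (suc i) = cong inject₁ (opposite-inject₁ i)

opposite-injective : Injective _≡_ _≡_ (opposite {r})
opposite-injective {x = i} {y = j} e =
  trans (sym (Fin.opposite-involutive i)) (trans (cong opposite e) (Fin.opposite-involutive j))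

reverse-trail : {R : Rel V 0ℓ} {p : Fin (suc r) → V} → Symmetric R → IsTrail R p → IsTrail R (p ∘ opposite)
reverse-trail {R = R} {p} R-sym t = record
  { steps = λ i → R-sym (subst (λ k → R (p (inject₁ (opposite i))) (p k)) (sym (opposite-inject₁ i)) (steps t (opposite i)))
  ; inj   = opposite-injective ∘ inj t
  }

trail-walk : {R : Rel V 0ℓ} {p : Fin (suc r) → V} → IsTrail R p → ∀ i → Star R (p zero) (p i)
trail-walk t = <-weakInduction _ ε (λ i w → w ◅◅ (steps t i ◅ ε))

consecutive : ∀ {i j : Fin (suc r)} → suc (toℕ i) ≡ toℕ j → ∃ λ k → i ≡ inject₁ k × j ≡ suc k
consecutive {j = suc j} e = j , Fin.toℕ-injective (trans (ℕ.suc-injective e) (sym (Fin.toℕ-inject₁ j))) , refl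

last-index : {i : Fin (suc r)} → suc (toℕ i) ≡ suc r → i ≡ fromℕ r
last-index {r} e = Fin.toℕ-injective (trans (ℕ.suc-injective e) (sym (Fin.toℕ-fromℕ r)))

cycle-edges : {E : Rel V 0ℓ} → Symmetric E → {p : Fin (suc r) → V} (3≤k : 3 ≤ suc r) →
              (∀ i → E (p (inject₁ i)) (p (suc i))) → E (p (fromℕ r)) (p zero) →
              ∀ i j → Adj (cycleGraph (suc r) 3≤k) i j → E (p i) (p j)
cycle-edges {r = r} {E} E-sym {p} _ p-steps closing i j = λ { (fwd c) → go c ; (bwd c) → E-sym (go c) }
  where
  go : ∀ {i j} → CyclicSuc (suc r) i j → E (p i) (p j)
  go (inj₁ e) with k , refl , refl ← consecutive e = p-steps k
  go {j = zero} (inj₂ (e , _)) with refl ← last-index e = closing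

module _ {V : Set} (_≟_ : DecidableEquality V) {R : Rel V 0ℓ} (R? : Decidable R) where

  record ChordlessPath (x y : V) : Set where
    constructor chordlessPath
    field
      {length}  : ℕ
      {nodeAt}  : Fin (suc length) → V
      trail     : IsTrail R nodeAt
      chordless : Chordless R nodeAt
      start     : nodeAt zero ≡ x
      end       : nodeAt (fromℕ length) ≡ y

  -- Drop the front of `p` up to the last vertex equal or related to `x`. If it equals `x`, the rest
  -- already starts at `x`; otherwise `x` goes in front, and no later vertex can give a chord.
  prepend : ∀ {r} {p : Fin (suc r) → V} → IsTrail R p → Chordless R p →
            ∀ {x} → (∃ λ i → x ≡ p i ⊎ R x (p i)) → ChordlessPath x (p (fromℕ r))
  prepend {r} {p} t c {x} touch with Fin.any? (λ j → (x ≟ p (suc j)) ⊎-dec R? x (p (suc j)))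
  prepend {suc r} t c touch | yes later = prepend (tail-trail t) (c ∘ s≤s) later
  ... | no ¬later with x ≟ p zero | touch
  ... | yes refl | _ = chordlessPath t c refl refl
  ... | no x≢p₀ | suc j , near = contradiction (j , near) ¬later
  ... | no x≢p₀ | zero , inj₁ e = contradiction e x≢p₀
  ... | no x≢p₀ | zero , inj₂ xRp₀ = chordlessPath (cons-trail xRp₀ x∉p t) c′ refl refl
    where
    x∉p : ∀ i → x ≢ p i
    x∉p zero    = x≢p₀
    x∉p (suc j) = λ e → ¬later (j , inj₁ e)
    c′ : Chordless R (x ∷ p)
    c′ {zero}  {suc zero}    (s≤s ())
    c′ {zero}  {suc (suc j)} _ = λ xRp → ¬later (j , inj₂ xRp)
    c′ {suc i} {suc j}       (s≤s lt) = c lt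

  walk⇒chordlessPath : ∀ {x y} → Star R x y → ChordlessPath x y
  walk⇒chordlessPath {x} ε = chordlessPath {length = 0} {nodeAt = λ _ → x}
    (record { steps = λ () ; inj = λ { {zero} {zero} _ → refl } }) (λ { {zero} {zero} () }) refl refl
  walk⇒chordlessPath (xRy ◅ w) with walk⇒chordlessPath w
  ... | chordlessPath t c refl refl = prepend t c (zero , inj₂ xRy)

-- Walks in trees

graph-≟ : Graph V → DecidableEquality V
graph-≟ G = via-injection (↔⇒↣ (↔-sym (proj₂ (finite G)))) Fin._≟_

finite-any? : Finite V → {P : Pred V 0ℓ} → (∀ x → Dec (P x)) → Dec (∃ P)
finite-any? (_ , Fin↔V) {P} P? = map′ (λ { (i , Pi) → to i , Pi })
                                      (λ { (x , Px) → from x , subst P (sym (inverseˡ refl)) Px })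
                                      (Fin.any? (P? ∘ to))
  where open Inverse Fin↔V

Off : Graph W → W → W → Rel W 0ℓ
Off T a b x y = Adj T x y × ¬ (x ≡ a × y ≡ b) × ¬ (x ≡ b × y ≡ a)

Off-sym : (T : Graph W) {a b : W} → Symmetric (Off T a b)
Off-sym T (e , ¬ab , ¬ba) = symAdj T e , (λ { (p , q) → ¬ba (q , p) }) , λ { (p , q) → ¬ab (q , p) }

-- Shorten the walk to a chordless path. Length 0 would make the edge a loop, length 1 would be the
-- deleted edge itself, and any longer path closes with it to a cycle.
bridge : (T : Graph W) → Acyclic (whole T) → ∀ {a b} → Adj T a b → ¬ Star (Off T a b) a b
bridge T acyclic {a} {b} ab w with walk⇒chordlessPath _≟_ off? w
  where
  _≟_ : DecidableEquality _
  _≟_ = graph-≟ T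
  off? : Decidable (Off T a b)
  off? x y = adj? T x y ×-dec ¬? ((x ≟ a) ×-dec (y ≟ b)) ×-dec ¬? ((x ≟ b) ×-dec (y ≟ a))
... | chordlessPath {length = 0} t c refl refl = irrAdj T refl ab
... | chordlessPath {length = 1} t c refl refl = proj₁ (proj₂ (steps t zero)) (refl , refl)
... | chordlessPath {length = suc (suc r)} t c refl refl =
  acyclic _ 3≤k (_ , inj t , cycle-edges {E = edge (whole T)} (λ {x} {y} → symEdge (whole T) {x} {y}) 3≤k
    (λ i → tt , tt , proj₁ (steps t i)) (tt , tt , symAdj T ab))
  where
  3≤k : 3 ≤ suc (suc (suc r))
  3≤k = s≤s (s≤s (s≤s z≤n))

acyclic-subgraph : {T : Graph W} → Acyclic (whole T) → (H : Subgraph T) → Acyclic H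
acyclic-subgraph acyclic H k 3≤k (f , f-inj , f-edge) =
  acyclic k 3≤k (f , f-inj , λ i j c → tt , tt , edge⇒adj H (f-edge i j c))

-- Both ends of an edge of `H` lie in `H`, so missing one end of `a b` is enough. Most walks fed to
-- `bridge` arise in this way.
walk-off : {T : Graph W} (H : Subgraph T) {a b : W} → (¬ node H a) ⊎ (¬ node H b) →
           ∀ {x y} → Star (edge H) x y → Star (Off T a b) x y
walk-off H {a} {b} miss = Star.map λ e → edge⇒adj H e
  , (λ { (refl , refl) → [ (λ a∉H → a∉H (source H e)) , (λ b∉H → b∉H (source H (symEdge H e))) ]′ miss })
  , (λ { (refl , refl) → [ (λ a∉H → a∉H (source H (symEdge H e))) , (λ b∉H → b∉H (source H e)) ]′ miss })

Avoiding : Rel W 0ℓ → Pred W 0ℓ → Rel W 0ℓ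
Avoiding R Q x y = R x y × ¬ Q x × ¬ Q y

-- The tail is treated first: either it contains the last exit already, or it avoids `Q` entirely
-- and the first step decides.
last-exit : {R : Rel W 0ℓ} {Q : Pred W 0ℓ} → (∀ x → Dec (Q x)) → ∀ {x y} → Star R x y → ¬ Q y →
            (Star (Avoiding R Q) x y × ¬ Q x) ⊎
            (∃ λ z → ∃ λ z′ → Q z × R z z′ × ¬ Q z′ × Star (Avoiding R Q) z′ y)
last-exit Q? ε y∉Q = inj₁ (ε , y∉Q)
last-exit Q? {x} (s ◅ w) y∉Q with last-exit Q? w y∉Q
... | inj₂ found = inj₂ found
... | inj₁ (w′ , x′∉Q) with Q? x
...   | yes x∈Q = inj₂ (_ , _ , x∈Q , s , x′∉Q , w′)
...   | no x∉Q  = inj₁ ((s , x∉Q , x′∉Q) ◅ w′ , x∉Q)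

-- NC-path-tree models give claw-free chordal graphs

module PathTreeModel {V W : Set} {G : Graph V} {T : Graph W} {P : V → Subgraph T}
                     (model : IsPathTreeModel G T P) where

  open IsPathTreeModel model
  open IsPath

  node? : ∀ v x → Dec (node (P v) x)
  node? v x = map′ (Equivalence.from (nodes (paths v) x)) (Equivalence.to (nodes (paths v) x))
                   (Fin.any? λ i → graph-≟ T (nodeAt (paths v) i) x)

  node-at : ∀ v i → node (P v) (nodeAt (paths v) i)
  node-at v i = Equivalence.from (nodes (paths v) _) (i , refl)

  path-trail : ∀ v → IsTrail (edge (P v)) (nodeAt (paths v))
  path-trail v = record
    { steps = λ i → Equivalence.from (edges (paths v) _ _) (fwd (cong suc (Fin.toℕ-inject₁ i)))
    ; inj   = injective (paths v)
    }

  path-connected : ∀ v → EmptyOrConnected (P v)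
  path-connected v x y xP yP
    with i , refl ← Equivalence.to (nodes (paths v) x) xP
       | j , refl ← Equivalence.to (nodes (paths v) y) yP
    = Star.reverse (symEdge (P v)) (trail-walk (path-trail v) i) ◅◅ trail-walk (path-trail v) j

  meet : ∀ {u v} → Adj G u v → Intersects (P u) (P v)
  meet {u} {v} uv = Equivalence.to (adjacency u v λ { refl → irrAdj G refl uv }) uv

  disjoint : ∀ {u v} → u ≢ v → ¬ Adj G u v → ∀ {x} → node (P u) x → ¬ node (P v) x
  disjoint u≢v ¬uv xu xv = ¬uv (Equivalence.from (adjacency _ _ u≢v) (_ , xu , xv))

  -- P v occupies index j of P c, so a walk of P c ∖ P v cannot step over it.
  below : ∀ {c v j} → node (P v) (nodeAt (paths c) j) →
          ∀ {x y} → Star (edge (P c ∖ P v)) x y →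
          ∀ {i k} → x ≡ nodeAt (paths c) i → y ≡ nodeAt (paths c) k → toℕ i < toℕ j → toℕ k < toℕ j
  below {c} at-j ε refl e i<j = subst (_< _) (cong toℕ (injective (paths c) e)) i<j
  below {c} {v} {j} at-j (_◅_ {j = z} s w) {i} refl ey i<j
    with l , refl ← Equivalence.to (nodes (paths c) z) (source (P c) (symEdge (P c) (proj₁ s)))
    = below {c} {v} {j} at-j w refl ey (l<j (Equivalence.to (edges (paths c) i l) (proj₁ s)))
    where
    l≢j : toℕ l ≢ toℕ j
    l≢j e with refl ← Fin.toℕ-injective e = proj₂ (proj₂ s) at-j
    l<j : SymClosure _ i l → toℕ l < toℕ j
    l<j (fwd e) = ℕ.≤∧≢⇒< (subst (_≤ toℕ j) e i<j) l≢j
    l<j (bwd e) = ℕ.<-trans (ℕ.≤-reflexive e) i<j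

  module _ (crossing-free : ∀ u v → u ≢ v → NonCrossing (P u) (P v)) where

    index : ∀ {c v} → Adj G c v → ∃ λ i → node (P v) (nodeAt (paths c) i)
    index {c} cv with meet cv
    ... | x , xc , xv with i , refl ← Equivalence.to (nodes (paths c) x) xc = i , xv

    -- Non-crossing of `P c` and `P y` supplies a walk from index `i` to index `k` off `P y`; by
    -- `below` it never gets past `j`.
    no-middle : ∀ {c x y z i j k} → c ≢ y → x ≢ y → y ≢ z → ¬ Adj G x y → ¬ Adj G y z →
                node (P x) (nodeAt (paths c) i) → node (P y) (nodeAt (paths c) j) →
                node (P z) (nodeAt (paths c) k) → toℕ i < toℕ j → ¬ toℕ j < toℕ k
    no-middle {c} {x} {y} {z} {i} {j} {k} c≢y x≢y y≢z ¬xy ¬yz ix jy kz i<j j<k =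
      ℕ.<-asym j<k (below {c} {y} {j} jy
        (proj₁ (crossing-free c y c≢y) _ _
          (node-at c i , disjoint x≢y ¬xy ix) (node-at c k , λ ky → disjoint y≢z ¬yz ky kz))
        refl refl i<j)

    clawFree : ClawFree G
    clawFree (f , f-inj , f-adj)
      with index (centre (suc zero) λ ()) | index (centre (suc (suc zero)) λ ()) | index (centre (suc (suc (suc zero))) λ ())
      where
      centre : ∀ i → i ≢ zero → Adj G (f zero) (f i)
      centre i i≢0 = Equivalence.to (f-adj zero i) (fwd (refl , i≢0))
    ... | i , ix | j , jy | k , kz = order
      where
      distinct : ∀ {a b} → a ≢ b → f a ≢ f b
      distinct a≢b = a≢b ∘ f-inj
      leaves : ∀ {a b} → a ≢ zero → b ≢ zero → ¬ Adj G (f a) (f b)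
      leaves {a} {b} a≢0 b≢0 ab with Equivalence.from (f-adj a b) ab
      ... | fwd (a≡0 , _) = a≢0 a≡0
      ... | bwd (b≡0 , _) = b≢0 b≡0
      middle : ∀ {a b c i j k} → b ≢ zero → a ≢ zero → c ≢ zero → a ≢ b → b ≢ c →
               node (P (f a)) (nodeAt (paths (f zero)) i) → node (P (f b)) (nodeAt (paths (f zero)) j) →
               node (P (f c)) (nodeAt (paths (f zero)) k) → toℕ i < toℕ j → ¬ toℕ j < toℕ k
      middle b≢0 a≢0 c≢0 a≢b b≢c =
        no-middle (distinct (b≢0 ∘ sym)) (distinct a≢b) (distinct b≢c) (leaves a≢0 b≢0) (leaves b≢0 c≢0)
      apart : ∀ {a b i j} → a ≢ zero → b ≢ zero → a ≢ b →
              node (P (f a)) (nodeAt (paths (f zero)) i) → node (P (f b)) (nodeAt (paths (f zero)) j) →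
              toℕ i ≢ toℕ j
      apart a≢0 b≢0 a≢b ia jb e with refl ← Fin.toℕ-injective e = disjoint (distinct a≢b) (leaves a≢0 b≢0) ia jb
      order : ⊥
      -- Equal indices would be a common node of two nonadjacent leaves. In each of the six strict
      -- orders some leaf is in the middle.
      order with ℕ.<-cmp (toℕ i) (toℕ j) | ℕ.<-cmp (toℕ j) (toℕ k) | ℕ.<-cmp (toℕ i) (toℕ k)
      ... | tri≈ _ e _ | _ | _ = apart (λ ()) (λ ()) (λ ()) ix jy e
      ... | _ | tri≈ _ e _ | _ = apart (λ ()) (λ ()) (λ ()) jy kz e
      ... | _ | _ | tri≈ _ e _ = apart (λ ()) (λ ()) (λ ()) ix kz e
      ... | tri< ij _ _ | tri< jk _ _ | _ = middle (λ ()) (λ ()) (λ ()) (λ ()) (λ ()) ix jy kz ij jk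
      ... | tri> _ _ ji | tri> _ _ kj | _ = middle (λ ()) (λ ()) (λ ()) (λ ()) (λ ()) kz jy ix kj ji
      ... | tri< ij _ _ | tri> _ _ kj | tri< ik _ _ = middle (λ ()) (λ ()) (λ ()) (λ ()) (λ ()) ix kz jy ik kj
      ... | tri< ij _ _ | tri> _ _ kj | tri> _ _ ki = middle (λ ()) (λ ()) (λ ()) (λ ()) (λ ()) kz ix jy ki ij
      ... | tri> _ _ ji | tri< jk _ _ | tri< ik _ _ = middle (λ ()) (λ ()) (λ ()) (λ ()) (λ ()) jy ix kz ji ik
      ... | tri> _ _ ji | tri< jk _ _ | tri> _ _ ki = middle (λ ()) (λ ()) (λ ()) (λ ()) (λ ()) jy kz ix jk ki

  -- Let P₁ leave P₀ for the last time through the edge z z′. The remaining part of P₁,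
  -- then P₂, P₃, … and finally P₀ lead from z′ back to z without using this edge.
  chordal : Chordal G
  chordal (suc (suc (suc (suc m)))) 4≤k@(s≤s (s≤s (s≤s (s≤s z≤n)))) (f , f-inj , f-adj)
    with meet (cyc zero (suc zero) (fwd (inj₁ refl)))
       | meet (cyc (suc zero) (suc (suc zero)) (fwd (inj₁ refl)))
    where
    cyc : ∀ i j → Adj (cycleGraph (suc (suc (suc (suc m)))) (s≤s (s≤s (s≤s z≤n)))) i j → Adj G (f i) (f j)
    cyc i j = Equivalence.to (f-adj i j)
  ... | x , x₀ , x₁ | y , y₁ , y₂ = around (last-exit (node? (f zero)) (path-connected (f (suc zero)) x y x₁ y₁) y∉P₀)
    where
    k : ℕ
    k = suc (suc (suc (suc m)))
    far : ∀ {i j} → i ≢ j → ¬ Adj (cycleGraph k (s≤s (s≤s (s≤s z≤n)))) i j →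
          ∀ {x} → node (P (f i)) x → ¬ node (P (f j)) x
    far i≢j ¬ij = disjoint (i≢j ∘ f-inj) (¬ij ∘ Equivalence.from (f-adj _ _))
    -- This uses length at least four: vertices 0 and 2 of the cycle are nonadjacent.
    y∉P₀ : ¬ node (P (f zero)) y
    y∉P₀ y₀ = far {zero} {suc (suc zero)} (λ ()) (λ { (fwd (inj₁ ())) ; (fwd (inj₂ (() , _))) ; (bwd (inj₁ ())) ; (bwd (inj₂ (() , _))) }) y₀ y₂
    around : (Star _ x y × ¬ node (P (f zero)) x) ⊎ _ → ⊥
    around (inj₁ (_ , x∉P₀)) = x∉P₀ x₀
    around (inj₂ (z , z′ , z₀ , zz′ , z′∉P₀ , w)) =
      bridge T (proj₂ tree) (edge⇒adj (P (f (suc zero))) zz′) (Star.reverse (Off-sym T) back)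
      where
      z₁ : node (P (f (suc zero))) z
      z₁ = source (P (f (suc zero))) zz′
      -- `z` lies on both `P₀` and `P₁`, and every other vertex of the cycle is nonadjacent to 0 or
      -- to 1.
      z∉P : ∀ i → ¬ node (P (f (suc (suc i)))) z
      z∉P zero zi = far {zero} {suc (suc zero)} (λ ()) (λ { (fwd (inj₁ ())) ; (fwd (inj₂ (() , _))) ; (bwd (inj₁ ())) ; (bwd (inj₂ (() , _))) }) z₀ zi
      z∉P (suc i) zi = far {suc zero} {suc (suc (suc i))} (λ ()) (λ { (fwd (inj₁ ())) ; (fwd (inj₂ (() , _))) ; (bwd (inj₁ ())) ; (bwd (inj₂ (_ , ()))) }) z₁ zi
      tour : ∀ i {u} → node (P (f (suc (suc i)))) u → Star (Off T z z′) z′ u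
      tour = <-weakInduction (λ i → ∀ {u} → node (P (f (suc (suc i)))) u → Star (Off T z z′) z′ u)
        -- `w` stays off `P₀`, which contains `z`, and ends at `y`, a node of `P₂`.
        (λ u₂ → Star.map (λ { (s , a∉P₀ , b∉P₀) → edge⇒adj (P (f (suc zero))) s , (λ { (refl , _) → a∉P₀ z₀ }) , (λ { (_ , refl) → b∉P₀ z₀ }) }) w
                 ◅◅ along zero y₂ u₂)
        step
        where
        along : ∀ i {a b} → node (P (f (suc (suc i)))) a → node (P (f (suc (suc i)))) b → Star (Off T z z′) a b
        along i {a} {b} aᵢ bᵢ = walk-off (P (f (suc (suc i)))) (inj₁ (z∉P i)) (path-connected _ a b aᵢ bᵢ)
        step : ∀ i → (∀ {u} → node (P (f (suc (suc (inject₁ i))))) u → Star (Off T z z′) z′ u) →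
               ∀ {u} → node (P (f (suc (suc (suc i))))) u → Star (Off T z z′) z′ u
        step i ih uᵢ with meet (Equivalence.to (f-adj (suc (suc (inject₁ i))) (suc (suc (suc i))))
                               (fwd (inj₁ (cong (λ t → suc (suc (suc t))) (Fin.toℕ-inject₁ i)))))
        ... | t , t₋ , tᵢ = ih t₋ ◅◅ along (suc i) tᵢ uᵢ
      back : Star (Off T z z′) z′ z
      back with meet (Equivalence.to (f-adj (suc (suc (fromℕ (suc m)))) zero)
                     (fwd (inj₂ (cong (λ t → suc (suc (suc t))) (Fin.toℕ-fromℕ (suc m)) , refl))))
      ... | t , tₗ , t₀ = tour (fromℕ (suc m)) tₗ
        ◅◅ walk-off (P (f zero)) (inj₂ z′∉P₀) (path-connected _ t z t₀ z₀)

-- Finiteness of decidable families of subsets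

refinement-finite : {P : Pred (Subset n) 0ℓ} → (∀ K → Dec (P K)) → Finite (Refinement (Subset n) P)
refinement-finite {zero} P? with P? Vec.[]
... | yes P[] = 1 , mk↔ₛ′ (λ _ → Vec.[] , [ P[] ]) (λ _ → zero) (λ { (Vec.[] , _) → refl }) (λ { zero → refl })
... | no ¬P[] = 0 , mk↔ₛ′ (λ ()) (λ { (Vec.[] , [ P[] ]) → ⊥-elim-irr (¬P[] P[]) })
                      (λ { (Vec.[] , [ P[] ]) → ⊥-elim-irr (¬P[] P[]) }) (λ ())
-- Split by membership of the first element; the two counts add up.
refinement-finite {suc n} P? with refinement-finite (P? ∘ (inside Vec.∷_)) | refinement-finite (P? ∘ (outside Vec.∷_))
... | k , fin-in | l , fin-out = k + l , mk↔ₛ′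
        [ (λ { (K , q) → inside Vec.∷ K , q }) , (λ { (K , q) → outside Vec.∷ K , q }) ]′
        (λ { (true Vec.∷ K , q) → inj₁ (K , q) ; (false Vec.∷ K , q) → inj₂ (K , q) })
        (λ { (true Vec.∷ K , q) → refl ; (false Vec.∷ K , q) → refl })
        (λ { (inj₁ _) → refl ; (inj₂ _) → refl })
      ↔-∘ ((fin-in ⊎-↔ fin-out) ↔-∘ Fin.+↔⊎)

-- Claws from pairwise apart vertices

Apart : Graph V → Rel V 0ℓ
Apart G x y = x ≢ y × ¬ Adj G x y

module _ {V : Set} {G : Graph V} where

  apart-sym : Symmetric (Apart G)
  apart-sym (x≢y , ¬xy) = x≢y ∘ sym , ¬xy ∘ symAdj G

  no-claw : ClawFree G → ∀ {c x y z} → Adj G c x → Adj G c y → Adj G c z →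
            Apart G x y → Apart G y z → ¬ Apart G x z
  no-claw claw-free {c} {x} {y} {z} cx cy cz xy yz xz = claw-free (f , f-inj , λ i j → mk⇔ to (from i j))
    where
    f : Fin 4 → V
    f = c ∷ (x ∷ (y ∷ λ _ → z))
    adj⇒≢ : ∀ {a b} → Adj G a b → a ≢ b
    adj⇒≢ ab refl = irrAdj G refl ab
    f-inj : Injective _≡_ _≡_ f
    f-inj = cons-injective (λ { zero → adj⇒≢ cx ; (suc zero) → adj⇒≢ cy ; (suc (suc zero)) → adj⇒≢ cz })
           (cons-injective (λ { zero → proj₁ xy ; (suc zero) → proj₁ xz })
           (cons-injective (λ { zero → proj₁ yz }) λ { {zero} {zero} _ → refl }))
    leg : ∀ j → j ≢ zero → Adj G c (f j)
    leg zero 0≢0 = ⊥-elim (0≢0 refl)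
    leg (suc zero) _ = cx
    leg (suc (suc zero)) _ = cy
    leg (suc (suc (suc zero))) _ = cz
    to : ∀ {i j} → Adj claw i j → Adj G (f i) (f j)
    to (fwd (refl , j≢0)) = leg _ j≢0
    to (bwd (refl , i≢0)) = symAdj G (leg _ i≢0)
    leaves : ∀ i j → Adj G (f (suc i)) (f (suc j)) → ⊥
    leaves zero zero = irrAdj G refl
    leaves zero (suc zero) = proj₂ xy
    leaves zero (suc (suc zero)) = proj₂ xz
    leaves (suc zero) zero = proj₂ xy ∘ symAdj G
    leaves (suc zero) (suc zero) = irrAdj G refl
    leaves (suc zero) (suc (suc zero)) = proj₂ yz
    leaves (suc (suc zero)) zero = proj₂ xz ∘ symAdj G
    leaves (suc (suc zero)) (suc zero) = proj₂ yz ∘ symAdj G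
    leaves (suc (suc zero)) (suc (suc zero)) = irrAdj G refl
    from : ∀ i j → Adj G (f i) (f j) → Adj claw i j
    from zero zero e = ⊥-elim (irrAdj G refl e)
    from zero (suc j) _ = fwd (refl , λ ())
    from (suc i) zero _ = bwd (refl , λ ())
    from (suc i) (suc j) e = ⊥-elim (leaves i j e)

-- Maximal cliques

module MaximalCliques {n : ℕ} (G : Graph (Fin n)) where

  infix 4 _∈ᶜ_ _∉ᶜ_

  _∈ᶜ_ _∉ᶜ_ : Fin n → MaximalClique G → Set
  v ∈ᶜ K = v ∈ value K
  v ∉ᶜ K = v ∉ value K

  _∈ᶜ?_ : ∀ v K → Dec (v ∈ᶜ K)
  v ∈ᶜ? K = v ∈? value K

  _≟ˢ_ : DecidableEquality (Subset n)
  _≟ˢ_ = Vec.≡-dec Bool._≟_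

  _≟ᶜ_ : DecidableEquality (MaximalClique G)
  _≟ᶜ_ = Refinement._≟_ _≟ˢ_

  clique? : ∀ K → Dec (IsClique G K)
  clique? K = Fin.all? λ u → Fin.all? λ v →
    u ∈? K →-dec (v ∈? K →-dec (¬? (u Fin.≟ v) →-dec adj? G u v))

  maximalClique? : ∀ K → Dec (IsMaximalClique G K)
  maximalClique? K = clique? K ×-dec map′ {A = ¬ ∃ λ L → IsClique G L × K ⊆ L × L ≢ K}
    (λ none L L-clique K⊆L → decidable-stable (L ≟ˢ K) λ L≢K → none (L , L-clique , K⊆L , L≢K))
    (λ { max (L , L-clique , K⊆L , L≢K) → L≢K (max L L-clique K⊆L) })
    (¬? (anySubset? λ L → clique? L ×-dec ((K ⊆? L) ×-dec ¬? (L ≟ˢ K))))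

  -- The proof stored in a refinement is irrelevant; deciding maximality recovers a usable one.
  isMaximal : ∀ K → IsMaximalClique G (value K)
  isMaximal (K , [ max ]) = recompute (maximalClique? K) max

  maximalClique-finite : Finite (MaximalClique G)
  maximalClique-finite = refinement-finite maximalClique?

  adj-in : ∀ K {u v} → u ∈ᶜ K → v ∈ᶜ K → u ≢ v → Adj G u v
  adj-in K u∈K v∈K u≢v = proj₁ (isMaximal K) _ _ u∈K v∈K u≢v

  insert-clique : ∀ {C x} → IsClique G C → (∀ y → y ∈ C → x ≢ y → Adj G x y) → IsClique G (⁅ x ⁆ ∪ C)
  insert-clique {C} {x} C-clique x-adj u v u∈ v∈ u≢v with x∈p∪q⁻ ⁅ x ⁆ C u∈ | x∈p∪q⁻ ⁅ x ⁆ C v∈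
  ... | inj₂ u∈C | inj₂ v∈C = C-clique u v u∈C v∈C u≢v
  ... | inj₁ u∈x | inj₂ v∈C with refl ← x∈⁅y⁆⇒x≡y x u∈x = x-adj v v∈C u≢v
  ... | inj₂ u∈C | inj₁ v∈x with refl ← x∈⁅y⁆⇒x≡y x v∈x = symAdj G (x-adj u u∈C (u≢v ∘ sym))
  ... | inj₁ u∈x | inj₁ v∈x = ⊥-elim (u≢v (trans (x∈⁅y⁆⇒x≡y x u∈x) (sym (x∈⁅y⁆⇒x≡y x v∈x))))

  -- Add vertices adjacent to the whole clique until there are none. Then any vertex of a larger
  -- clique outside `C` would have been such a vertex.
  extend : ∀ C → IsClique G C → ∃ λ K → ∀ {x} → x ∈ C → x ∈ᶜ K
  extend C = go C (⊃-wellFounded C)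
    where
    go : ∀ C → Acc _⊃_ C → IsClique G C → ∃ λ K → ∀ {x} → x ∈ C → x ∈ᶜ K
    go C (acc larger) C-clique
      with Fin.any? (λ x → ¬? (x ∈? C) ×-dec Fin.all? (λ y → y ∈? C →-dec (¬? (x Fin.≟ y) →-dec adj? G x y)))
    ... | yes (x , x∉C , x-adj) =
      let K , C⁺⊆K = go (⁅ x ⁆ ∪ C)
                        (larger (q⊆p∪q ⁅ x ⁆ C , x , x∈p∪q⁺ (inj₁ (x∈⁅x⁆ x)) , x∉C))
                        (insert-clique C-clique x-adj)
      in K , C⁺⊆K ∘ q⊆p∪q ⁅ x ⁆ C
    ... | no none = (C , [ C-clique , maximal ]) , λ x∈C → x∈C
      where
      maximal : ∀ L → IsClique G L → C ⊆ L → L ≡ C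
      maximal L L-clique C⊆L = ⊆-antisym
        (λ {x} x∈L → decidable-stable (x ∈? C) λ x∉C → none (x , x∉C , λ y y∈C → L-clique x y x∈L (C⊆L y∈C)))
        C⊆L

  singleton-clique : ∀ x → IsClique G ⁅ x ⁆
  singleton-clique x u v u∈ v∈ u≢v = ⊥-elim (u≢v (trans (x∈⁅y⁆⇒x≡y x u∈) (sym (x∈⁅y⁆⇒x≡y x v∈))))

  vertex-clique : ∀ x → ∃ λ K → x ∈ᶜ K
  vertex-clique x with K , ⊆K ← extend ⁅ x ⁆ (singleton-clique x) = K , ⊆K (x∈⁅x⁆ x)

  edge-clique : ∀ {x y} → Adj G x y → ∃ λ K → x ∈ᶜ K × y ∈ᶜ K
  edge-clique {x} {y} xy
    with K , ⊆K ← extend (⁅ x ⁆ ∪ ⁅ y ⁆)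
      (insert-clique (singleton-clique y) λ v v∈y _ → subst (Adj G x) (sym (x∈⁅y⁆⇒x≡y y v∈y)) xy)
    = K , ⊆K (x∈p∪q⁺ (inj₁ (x∈⁅x⁆ x))) , ⊆K (x∈p∪q⁺ (inj₂ (x∈⁅x⁆ y)))

  -- Every vertex and every edge lies in some maximal clique.
  apart : ∀ {x y} → (∀ K → x ∈ᶜ K → y ∉ᶜ K) → Apart G x y
  apart {x} none = (λ { refl → let K , x∈K = vertex-clique x in none K x∈K x∈K })
                 , (λ xy → let K , x∈K , y∈K = edge-clique xy in none K x∈K y∈K)

  outside-vertex : ∀ {K L} → K ≢ L → ∃ λ x → x ∈ᶜ K × x ∉ᶜ L
  outside-vertex {K} {L} K≢L with Fin.any? (λ x → (x ∈ᶜ? K) ×-dec ¬? (x ∈ᶜ? L))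
  ... | yes found = found
  ... | no none = ⊥-elim (K≢L (value-injective (sym (proj₂ (isMaximal K) (value L) (proj₁ (isMaximal L))
                    λ {x} x∈K → decidable-stable (x ∈ᶜ? L) λ x∉L → none (x , x∈K , x∉L)))))

  -- Otherwise `K` together with `x` would be a larger clique.
  apart-vertex : ∀ {K x} → x ∉ᶜ K → ∃ λ y → y ∈ᶜ K × Apart G x y
  apart-vertex {K} {x} x∉K with Fin.any? (λ y → (y ∈ᶜ? K) ×-dec ¬? (adj? G x y))
  ... | yes (y , y∈K , ¬xy) = y , y∈K , (λ { refl → x∉K y∈K }) , ¬xy
  ... | no none = ⊥-elim (x∉K (subst (x ∈_) maximal (x∈p∪q⁺ (inj₁ (x∈⁅x⁆ x)))))
    where
    maximal : ⁅ x ⁆ ∪ value K ≡ value K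
    maximal = proj₂ (isMaximal K) _
      (insert-clique (proj₁ (isMaximal K)) λ y y∈K _ → decidable-stable (adj? G x y) λ ¬xy → none (y , y∈K , ¬xy))
      (q⊆p∪q ⁅ x ⁆ (value K))

  -- The empty set is a maximal clique only in the graph without vertices.
  clique-inhabited : ConnectedGraph G → ∀ K → ∃ λ v → v ∈ᶜ K
  clique-inhabited ((v , _) , _) K with v ∈ᶜ? K
  ... | yes v∈K = v , v∈K
  ... | no v∉K  = let y , y∈K , _ = apart-vertex {K} v∉K in y , y∈K

  -- Each edge of the walk lies in a maximal clique, and `hop` moves between cliques that share a
  -- vertex.
  clique-chain : {R : Rel (MaximalClique G) 0ℓ} → (∀ v {K L} → v ∈ᶜ K → v ∈ᶜ L → Star R K L) →
                 ∀ {x y} → Star (edge (whole G)) x y → ∀ {K L} → x ∈ᶜ K → y ∈ᶜ L → Star R K L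
  clique-chain hop {x} ε x∈K x∈L = hop x x∈K x∈L
  clique-chain hop {x} ((_ , _ , xz) ◅ w) x∈K y∈L with edge-clique xz
  ... | M , x∈M , z∈M = hop x {L = M} x∈K x∈M ◅◅ clique-chain hop w z∈M y∈L

  edge-clique-over : ∀ {C x y} → IsClique G C → (∀ s → s ∈ C → x ≢ s → Adj G x s) →
                     (∀ s → s ∈ C → y ≢ s → Adj G y s) → Adj G x y →
                     ∃ λ K → (∀ s → s ∈ C → s ∈ᶜ K) × x ∈ᶜ K × y ∈ᶜ K
  edge-clique-over {C} {x} {y} C-clique x-adj y-adj xy
    with K , ⊆K ← extend (⁅ x ⁆ ∪ (⁅ y ⁆ ∪ C)) (insert-clique (insert-clique C-clique y-adj) λ z z∈ x≢z →
      [ (λ z∈y → subst (Adj G x) (sym (x∈⁅y⁆⇒x≡y y z∈y)) xy) , (λ z∈C → x-adj z z∈C x≢z) ]′ (x∈p∪q⁻ ⁅ y ⁆ C z∈))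
    = K , (λ s s∈C → ⊆K (x∈p∪q⁺ (inj₂ (x∈p∪q⁺ (inj₂ s∈C)))))
        , ⊆K (x∈p∪q⁺ (inj₁ (x∈⁅x⁆ x))) , ⊆K (x∈p∪q⁺ (inj₂ (x∈p∪q⁺ (inj₁ (x∈⁅x⁆ y)))))

  Contains : MaximalClique G → MaximalClique G → MaximalClique G → Set
  Contains K L M = ∀ v → v ∈ᶜ K → v ∈ᶜ L → v ∈ᶜ M

  contains? : ∀ K L M → Dec (Contains K L M)
  contains? K L M = Fin.all? λ v → (v ∈ᶜ? K) →-dec ((v ∈ᶜ? L) →-dec (v ∈ᶜ? M))

  Third : MaximalClique G → MaximalClique G → Set
  Third K L = ∃ λ M → Contains K L M × M ≢ K × M ≢ L

  third? : ∀ K L → Dec (Third K L)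
  third? K L = finite-any? maximalClique-finite λ M → contains? K L M ×-dec (¬? (M ≟ᶜ K) ×-dec ¬? (M ≟ᶜ L))

  -- The adjacency of the only possible clique tree of a connected claw-free graph.
  Close : Rel (MaximalClique G) 0ℓ
  Close K L = K ≢ L × ¬ Third K L

  close? : Decidable Close
  close? K L = ¬? (K ≟ᶜ L) ×-dec ¬? (third? K L)

  closeGraph : Graph (MaximalClique G)
  closeGraph = record
    { finite = maximalClique-finite
    ; Adj    = Close
    ; adj?   = close?
    ; symAdj = λ { (K≢L , ¬third) → K≢L ∘ sym , λ { (M , ⊆M , M≢L , M≢K) → ¬third (M , (λ v v∈K v∈L → ⊆M v v∈L v∈K) , M≢K , M≢L) } }
    ; irrAdj = λ { K≡L (K≢L , _) → K≢L K≡L }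
    }

-- Connected subgraphs of maximum degree two in a tree are paths

module _ {W : Set} {T : Graph W} (acyclic : Acyclic (whole T)) (H : Subgraph T)
         (edge? : Decidable (edge H)) where

  private
    _≟_ : DecidableEquality W
    _≟_ = graph-≟ T

    Stuck : Pred W 0ℓ → Pred W 0ℓ
    Stuck Q x = ∀ y → edge H x y → Q y

    OnTrail : (Fin (suc r) → W) → Pred W 0ℓ
    OnTrail p x = ∃ λ i → p i ≡ x

  record MaximalExtension {r : ℕ} (p : Fin (suc r) → W) : Set where
    field
      {length} : ℕ
      {nodeAt} : Fin (suc length) → W
      trail    : IsTrail (edge H) nodeAt
      end      : nodeAt (fromℕ length) ≡ p (fromℕ r)
      extends  : ∀ i → OnTrail nodeAt (p i)
      stuck    : Stuck (OnTrail nodeAt) (nodeAt zero)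

  maximal-extension : {p : Fin (suc r) → W} → IsTrail (edge H) p → MaximalExtension p
  maximal-extension = grow _ (ℕ.m≤n+m _ _)
    where
    -- A trail has `r + 1` distinct nodes, so without fuel the bound contradicts the number of nodes
    -- of `T`.
    grow : ∀ fuel {r} → proj₁ (finite T) ≤ r + fuel → {p : Fin (suc r) → W} →
           IsTrail (edge H) p → MaximalExtension p
    grow fuel bound {p} t
      with finite-any? (finite T) (λ y → edge? (p zero) y ×-dec Fin.all? (λ i → ¬? (y ≟ p i)))
    grow fuel bound {p} t | no none = record
      { trail = t ; end = refl ; extends = λ i → i , refl ; stuck = stuck }
      where
      stuck : Stuck (OnTrail p) (p zero)
      stuck y e = decidable-stable (Fin.any? λ i → p i ≟ y)
        λ y∉p → none (y , e , λ i y≡pᵢ → y∉p (i , sym y≡pᵢ))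
    grow zero {r} bound {p} t | yes _ =
      ⊥-elim (ℕ.<-irrefl refl (ℕ.≤-trans (Fin.injective⇒≤ index-inj) (subst (_ ≤_) (ℕ.+-identityʳ r) bound)))
      where
      open Inverse (proj₂ (finite T))
      index-inj : Injective _≡_ _≡_ (from ∘ p)
      index-inj e = inj t (trans (sym (inverseˡ refl)) (trans (cong to e) (inverseˡ refl)))
    grow (suc fuel) {r} bound t | yes (y , e , y∉p) = record
      { trail = trail ; end = end ; extends = extends ∘ suc ; stuck = stuck }
      where
      open MaximalExtension (grow fuel (subst (proj₁ (finite T) ≤_) (ℕ.+-suc r fuel) bound) (cons-trail (symEdge H e) y∉p t))

  module _ (connected : Connected H)
           (degree≤2 : ∀ {x a b c} → edge H x a → edge H x b → edge H x c → a ≢ b → b ≢ c → ¬ a ≢ c) where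

    module _ {r : ℕ} {p : Fin (suc r) → W} (t : IsTrail (edge H) p)
             (start-stuck : Stuck (OnTrail p) (p zero)) (end-stuck : Stuck (OnTrail p) (p (fromℕ r)))
             {x₀ : W} (x₀∈H : node H x₀) (x₀∈p : OnTrail p x₀) where

      private
        -- An inner node has its predecessor and its successor as neighbours; a neighbour off the
        -- trail would be a third one.
        trail-stuck : ∀ i → Stuck (OnTrail p) (p i)
        trail-stuck i y e with view i
        ... | ‵fromℕ = end-stuck y e
        ... | ‵inject₁ zero = start-stuck y e
        ... | ‵inject₁ (suc k) with p (inject₁ (inject₁ k)) ≟ y | p (suc (suc k)) ≟ y
        ...   | yes prev | _ = _ , prev
        ...   | _ | yes next = _ , next
        ...   | no prev≢y | no next≢y =
          ⊥-elim (degree≤2 (symEdge H (steps t (inject₁ k))) (steps t (suc k)) e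
                           (prev≢next ∘ cong toℕ ∘ inj t) next≢y prev≢y)
          where
          prev≢next : toℕ (inject₁ (inject₁ k)) ≢ suc (suc (toℕ k))
          prev≢next eq = ℕ.<-irrefl (trans (sym (trans (Fin.toℕ-inject₁ (inject₁ k)) (Fin.toℕ-inject₁ k))) eq)
                                    (ℕ.m≤n⇒m≤1+n ℕ.≤-refl)

        along : ∀ {x y} → Star (edge H) x y → OnTrail p x → OnTrail p y
        along ε x∈p = x∈p
        along (s ◅ w) (i , refl) = along w (trail-stuck i _ s)

        target : ∀ {x y} → Star (edge H) x y → node H x → node H y
        target ε x∈H = x∈H
        target (s ◅ w) _ = target w (source H (symEdge H s))

        between : {R : Rel W 0ℓ} → Symmetric R → IsTrail R p → ∀ i j → Star R (p i) (p j)
        between R-sym t i j = Star.reverse R-sym (trail-walk t i) ◅◅ trail-walk t j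

        -- The trail joins the ends of the chord through consecutive nodes only, so without the
        -- chord itself, against `bridge`.
        no-chord : ∀ {i j} → suc (toℕ i) < toℕ j → ¬ edge H (p i) (p j)
        no-chord {i} {j} i+1<j e = bridge T acyclic (edge⇒adj H e)
          (between (Off-sym T) (record { steps = λ k → edge⇒adj H (steps t k) , same k , swapped k ; inj = inj t }) i j)
          where
          same : ∀ k → ¬ (p (inject₁ k) ≡ p i × p (suc k) ≡ p j)
          same k (eᵢ , eⱼ) with refl ← inj t eᵢ | refl ← inj t eⱼ =
            ℕ.<-irrefl (cong suc (Fin.toℕ-inject₁ k)) i+1<j
          swapped : ∀ k → ¬ (p (inject₁ k) ≡ p j × p (suc k) ≡ p i)
          swapped k (eⱼ , eᵢ) with refl ← inj t eᵢ | refl ← inj t eⱼ =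
            ℕ.<-asym (subst (suc (suc (toℕ k)) <_) (Fin.toℕ-inject₁ k) i+1<j) (ℕ.m≤n⇒m≤1+n ℕ.≤-refl)

        edge⇒consecutive : ∀ i j → edge H (p i) (p j) → Adj (pathGraph (suc r)) i j
        edge⇒consecutive i j e with ℕ.<-cmp (toℕ i) (toℕ j)
        ... | tri≈ _ i≡j _ = ⊥-elim (irrAdj T (cong p (Fin.toℕ-injective i≡j)) (edge⇒adj H e))
        ... | tri< i<j _ _ with ℕ.m≤n⇒m<n∨m≡n i<j
        ...   | inj₁ i+1<j = ⊥-elim (no-chord i+1<j e)
        ...   | inj₂ i+1≡j = fwd i+1≡j
        edge⇒consecutive i j e | tri> _ _ j<i with ℕ.m≤n⇒m<n∨m≡n j<i
        ...   | inj₁ j+1<i = ⊥-elim (no-chord j+1<i (symEdge H e))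
        ...   | inj₂ j+1≡i = bwd j+1≡i

        consecutive⇒edge : ∀ i j → suc (toℕ i) ≡ toℕ j → edge H (p i) (p j)
        consecutive⇒edge i j c with k , refl , refl ← consecutive c = steps t k

      -- The trail is closed under neighbours and `H` is connected, so it reaches every node. The
      -- node `x₀` is there because a trail without steps need not lie in `H`.
      maximal-trail⇒isPath : IsPath H
      maximal-trail⇒isPath = record
        { length    = r
        ; nodeAt    = p
        ; injective = inj t
        ; nodes     = λ x → mk⇔
            (λ x∈H → along (proj₂ connected x₀ x x₀∈H x∈H) x₀∈p)
            (λ { (i , refl) → let j , pⱼ≡x₀ = x₀∈p in
                 target (between (symEdge H) t j i) (subst (node H) (sym pⱼ≡x₀) x₀∈H) })
        ; edges     = λ i j → mk⇔ (edge⇒consecutive i j)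
            λ { (fwd c) → consecutive⇒edge i j c ; (bwd c) → symEdge H (consecutive⇒edge j i c) }
        }

    private
      opposite-fromℕ : ∀ m → opposite (fromℕ m) ≡ zero
      opposite-fromℕ zero    = refl
      opposite-fromℕ (suc m) = cong inject₁ (opposite-fromℕ m)

      -- Extensions grow at the front only: grow from `x₀`, reverse, grow again. The second trail
      -- contains the first and ends where the first got stuck, so it is stuck at both ends.
      grown-both-ways⇒isPath : ∀ {x₀} → node H x₀ → (E₁ : MaximalExtension {0} (λ _ → x₀)) →
        MaximalExtension (MaximalExtension.nodeAt E₁ ∘ opposite) → IsPath H
      grown-both-ways⇒isPath x₀∈H E₁ E₂ = maximal-trail⇒isPath E₂.trail E₂.stuck
        (λ y e → let i , eᵢ = E₁.stuck y (subst (λ x → edge H x y) E₂-end e) in onE₂ i eᵢ)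
        x₀∈H (let i , eᵢ = E₁.extends zero in onE₂ i eᵢ)
        where
        module E₁ = MaximalExtension E₁
        module E₂ = MaximalExtension E₂
        E₂-end : E₂.nodeAt (fromℕ E₂.length) ≡ E₁.nodeAt zero
        E₂-end = trans E₂.end (cong E₁.nodeAt (opposite-fromℕ E₁.length))
        onE₂ : ∀ {y} i → E₁.nodeAt i ≡ y → ∃ λ j → E₂.nodeAt j ≡ y
        onE₂ i refl with j , eⱼ ← E₂.extends (opposite i) = j , trans eⱼ (cong E₁.nodeAt (Fin.opposite-involutive i))

    isPath : IsPath H
    isPath = grown-both-ways⇒isPath (proj₂ (proj₁ connected)) E₁
      (maximal-extension (reverse-trail (symEdge H) (MaximalExtension.trail E₁)))
      where
      E₁ : MaximalExtension {0} (λ _ → proj₁ (proj₁ connected))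
      E₁ = maximal-extension (record { steps = λ () ; inj = λ { {zero} {zero} _ → refl } })

-- Clique trees of claw-free graphs are NC-path-tree models

module CliqueTree {n : ℕ} {G : Graph (Fin n)} {T : Graph (MaximalClique G)} (isCliqueTree : IsCliqueTree G T) where

  open MaximalCliques G

  T-acyclic : Acyclic (whole T)
  T-acyclic = proj₂ (proj₁ isCliqueTree)

  walk-in : ∀ v {K L} → v ∈ᶜ K → v ∈ᶜ L → Star (edge (cliqueSubtree G T v)) K L
  walk-in v = proj₂ (proj₁ (proj₂ isCliqueTree v)) _ _

  off-walk : ∀ {v A B} → v ∉ᶜ A ⊎ v ∉ᶜ B → ∀ {K L} → v ∈ᶜ K → v ∈ᶜ L → Star (Off T A B) K L
  off-walk {v} miss v∈K v∈L = walk-off (cliqueSubtree G T v) miss (walk-in v v∈K v∈L)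

  T-irr : ∀ {K L} → Adj T K L → K ≢ L
  T-irr KL refl = irrAdj T refl KL

  -- A clique `M` containing both vertices would give a walk around the edge: from `K₁` to `M` in
  -- the subtree of `w₁`, on to `L` in that of `w₂`, and back to `K`.
  apart-across : ∀ {K₁ K L w₁ w₂} → Adj T K₁ K → w₁ ∈ᶜ K₁ → w₁ ∉ᶜ K → w₂ ∉ᶜ K₁ ⊎ w₂ ∉ᶜ K →
                 w₂ ∈ᶜ L → Star (Off T K₁ K) K L → Apart G w₁ w₂
  apart-across K₁K w₁∈K₁ w₁∉K w₂-misses w₂∈L K⟶L = apart λ M w₁∈M w₂∈M →
    bridge T T-acyclic K₁K
      (off-walk (inj₂ w₁∉K) {L = M} w₁∈K₁ w₁∈M ◅◅ off-walk w₂-misses w₂∈M w₂∈L ◅◅ Star.reverse (Off-sym T) K⟶L)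

  -- Otherwise every subtree misses an end of the edge, and a walk of `G` from `K` to `L` lifts to a
  -- walk of `T` around that edge.
  common-vertex : ConnectedGraph G → ∀ {K L} → Adj T K L → ∃ λ v → v ∈ᶜ K × v ∈ᶜ L
  common-vertex G-conn {K} {L} KL with Fin.any? (λ v → (v ∈ᶜ? K) ×-dec (v ∈ᶜ? L))
  ... | yes found = found
  ... | no none with outside-vertex (T-irr KL) | outside-vertex (T-irr KL ∘ sym)
  ... | a , a∈K , _ | b , b∈L , _ = ⊥-elim (bridge T T-acyclic KL (clique-chain (λ v → off-walk (misses v)) (proj₂ G-conn a b tt tt) a∈K b∈L))
    where
    misses : ∀ v → v ∉ᶜ K ⊎ v ∉ᶜ L
    misses v with v ∈ᶜ? K
    ... | yes v∈K = inj₂ λ v∈L → none (v , v∈K , v∈L)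
    ... | no v∉K  = inj₁ v∉K

  module _ (claw-free : ClawFree G) where

    -- Each of three distinct neighbours of `K` has a vertex outside `K`. These three are pairwise
    -- apart, and `v` is adjacent to all of them.
    degree≤2 : ∀ v {K K₁ K₂ K₃} → edge (cliqueSubtree G T v) K K₁ → edge (cliqueSubtree G T v) K K₂ →
               edge (cliqueSubtree G T v) K K₃ → K₁ ≢ K₂ → K₂ ≢ K₃ → ¬ K₁ ≢ K₃
    degree≤2 v {K} {K₁} {K₂} {K₃} (v∈K , v∈K₁ , KK₁) (_ , v∈K₂ , KK₂) (_ , v∈K₃ , KK₃) K₁≢K₂ K₂≢K₃ K₁≢K₃
      with outside-vertex (T-irr KK₁ ∘ sym) | outside-vertex (T-irr KK₂ ∘ sym) | outside-vertex (T-irr KK₃ ∘ sym)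
    ... | w₁ , w₁∈K₁ , w₁∉K | w₂ , w₂∈K₂ , w₂∉K | w₃ , w₃∈K₃ , w₃∉K =
      no-claw {G = G} claw-free
        (adj-in K₁ v∈K₁ w₁∈K₁ (λ { refl → w₁∉K v∈K }))
        (adj-in K₂ v∈K₂ w₂∈K₂ (λ { refl → w₂∉K v∈K }))
        (adj-in K₃ v∈K₃ w₃∈K₃ (λ { refl → w₃∉K v∈K }))
        (branches KK₁ KK₂ K₁≢K₂ w₁∈K₁ w₁∉K w₂∈K₂ w₂∉K)
        (branches KK₂ KK₃ K₂≢K₃ w₂∈K₂ w₂∉K w₃∈K₃ w₃∉K)
        (branches KK₁ KK₃ K₁≢K₃ w₁∈K₁ w₁∉K w₃∈K₃ w₃∉K)
      where
      branches : ∀ {A B a b} → Adj T K A → Adj T K B → A ≢ B → a ∈ᶜ A → a ∉ᶜ K → b ∈ᶜ B → b ∉ᶜ K → Apart G a b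
      branches KA KB A≢B a∈A a∉K b∈B b∉K = apart-across (symAdj T KA) a∈A a∉K (inj₂ b∉K) b∈B
        ((KB , (λ { (_ , B≡K) → T-irr KB (sym B≡K) }) , λ { (_ , B≡A) → A≢B (sym B≡A) }) ◅ ε)

    -- The subtree of `u` crosses the border of that of `v` at `K₁ K` and at `L₁ L`. If `K₁` and
    -- `L₁` differ, `u` is the centre of a claw with leaves `v`, `w₁` in `K₁` and `w₂` in `L₁`.
    same-exit : ∀ {u v K₁ K L₁ L} → edge (cliqueSubtree G T u) K₁ K → edge (cliqueSubtree G T u) L₁ L →
                v ∈ᶜ K → v ∈ᶜ L → v ∉ᶜ K₁ → v ∉ᶜ L₁ → K₁ ≡ L₁
    same-exit {u} {v} {K₁} {K} {L₁} {L} (u∈K₁ , u∈K , K₁K) (u∈L₁ , u∈L , L₁L) v∈K v∈L v∉K₁ v∉L₁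
      with K₁ ≟ᶜ L₁ | outside-vertex (T-irr K₁K) | outside-vertex (T-irr L₁L)
    ... | yes K₁≡L₁ | _ | _ = K₁≡L₁
    ... | no K₁≢L₁ | w₁ , w₁∈K₁ , w₁∉K | w₂ , w₂∈L₁ , w₂∉L = ⊥-elim
      (no-claw {G = G} claw-free
        (adj-in K₁ u∈K₁ w₁∈K₁ (λ { refl → w₁∉K u∈K }))
        (adj-in K u∈K v∈K (λ { refl → v∉K₁ u∈K₁ }))
        (adj-in L₁ u∈L₁ w₂∈L₁ (λ { refl → w₂∉L u∈L }))
        w₁v (apart-sym {G = G} w₂v) w₁w₂)
      where
      w₁v : Apart G w₁ v
      w₁v = apart-across K₁K w₁∈K₁ w₁∉K (inj₁ v∉K₁) v∈K ε
      w₂v : Apart G w₂ v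
      w₂v = apart-across L₁L w₂∈L₁ w₂∉L (inj₁ v∉L₁) v∈L ε
      w₂∉K : w₂ ∉ᶜ K
      w₂∉K w₂∈K = proj₂ w₂v (adj-in K w₂∈K v∈K (proj₁ w₂v))
      w₁w₂ : Apart G w₁ w₂
      -- Go from `K` to `L` inside the subtree of `v`, which misses `K₁`, then step to `L₁`.
      w₁w₂ = apart-across K₁K w₁∈K₁ w₁∉K (inj₂ w₂∉K) w₂∈L₁
        (off-walk (inj₁ v∉K₁) v∈K v∈L ◅◅
          ((symAdj T L₁L , (λ { (refl , _) → v∉K₁ v∈L }) , λ { (_ , L₁≡K₁) → K₁≢L₁ (sym L₁≡K₁) }) ◅ ε))

    -- Each excursion of the walk into T_v returns to the clique it left from.
    subtree-∖-connected : ∀ u v → EmptyOrConnected (cliqueSubtree G T u ∖ cliqueSubtree G T v)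
    subtree-∖-connected u v x y (u∈x , v∉x) (u∈y , v∉y) = stay-out v∉x (walk-in u u∈x u∈y)
      where
      stay-out : ∀ {x} → v ∉ᶜ x → Star (edge (cliqueSubtree G T u)) x y →
                Star (edge (cliqueSubtree G T u ∖ cliqueSubtree G T v)) x y
      stay-in : ∀ {x K L} → edge (cliqueSubtree G T u) x K → v ∉ᶜ x → v ∈ᶜ K → v ∈ᶜ L →
               Star (edge (cliqueSubtree G T u)) L y →
               Star (edge (cliqueSubtree G T u ∖ cliqueSubtree G T v)) x y
      stay-out v∉x ε = ε
      stay-out v∉x (_◅_ {j = z} s w) with v ∈ᶜ? z
      ... | yes v∈z = stay-in s v∉x v∈z v∈z w
      ... | no v∉z  = (s , v∉x , v∉z) ◅ stay-out v∉z w
      stay-in xK v∉x v∈K v∈L ε = ⊥-elim (v∉y v∈L)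
      stay-in xK v∉x v∈K v∈L (_◅_ {j = z} s w) with v ∈ᶜ? z
      ... | yes v∈z = stay-in xK v∉x v∈K v∈z w
      ... | no v∉z with refl ← same-exit xK (symEdge (cliqueSubtree G T u) s) v∈K v∈L v∉x v∉z = stay-out v∉x w

    isNCPathTreeModel : ConnectedGraph G → IsNCPathTreeModel G T (cliqueSubtree G T)
    isNCPathTreeModel G-conn = record
      { tree         = proj₁ isCliqueTree
      ; paths        = λ v → isPath T-acyclic (cliqueSubtree G T v)
          (λ K L → (v ∈ᶜ? K) ×-dec ((v ∈ᶜ? L) ×-dec adj? T K L))
          (proj₁ (proj₂ isCliqueTree v)) (degree≤2 v)
      ; nodesCovered = clique-inhabited G-conn
      ; edgesCovered = λ K L KL → let v , v∈K , v∈L = common-vertex G-conn KL in v , v∈K , v∈L , KL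
      ; adjacency    = λ u v u≢v → mk⇔ edge-clique λ { (K , u∈K , v∈K) → adj-in K u∈K v∈K u≢v }
      } , λ u v _ → subtree-∖-connected u v , subtree-∖-connected v u

-- Uniqueness: adjacency in a clique tree is closeness

module _ {n : ℕ} {G : Graph (Fin n)} {T : Graph (MaximalClique G)} (isCliqueTree : IsCliqueTree G T) where

  open MaximalCliques G
  open CliqueTree {G = G} {T = T} isCliqueTree

  private
    tree-walk : ∀ K L → Star (Adj T) K L
    tree-walk K L = Star.map (λ { (_ , _ , e) → e }) (proj₂ (proj₁ (proj₁ isCliqueTree)) K L tt tt)

    avoiding⇒off : ∀ {A B K L} → Star (Avoiding (Adj T) (_≡ A)) K L → Star (Off T A B) K L
    avoiding⇒off = Star.map λ { (e , x≢A , y≢A) → e , (λ { (x≡A , _) → x≢A x≡A }) , λ { (_ , y≡A) → y≢A y≡A } }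

    -- If `v` missed `K′`, its subtree would join `K` to `L` without the edge `K K′`, and `w`
    -- reversed would lead on to `K′`.
    first-step-contains : ∀ {K K′ L} → Adj T K K′ → Star (Avoiding (Adj T) (_≡ K)) K′ L → Contains K L K′
    first-step-contains {K} {K′} {L} KK′ w v v∈K v∈L = decidable-stable (v ∈ᶜ? K′) λ v∉K′ →
      bridge T T-acyclic KK′ (off-walk (inj₂ v∉K′) v∈K v∈L ◅◅ Star.reverse (Off-sym T) (avoiding⇒off w))

  -- The neighbour through which a walk to `L` last leaves `K` contains `K ∩ L`; since it cannot be
  -- a third clique, it is `L`.
  close⇒adjacent : ∀ {K L} → Close K L → Adj T K L
  close⇒adjacent {K} {L} (K≢L , ¬third) with last-exit (_≟ᶜ K) (tree-walk K L) (K≢L ∘ sym)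
  ... | inj₁ (_ , K≢K) = ⊥-elim (K≢K refl)
  ... | inj₂ (_ , K′ , refl , KK′ , K′≢K , w) with K′ ≟ᶜ L
  ...   | yes refl = KK′
  ...   | no K′≢L  = ⊥-elim (¬third (K′ , first-step-contains KK′ w , K′≢K , K′≢L))

  module _ (G-conn : ConnectedGraph G) (claw-free : ClawFree G) where

    private
      -- If `M` contained `K ∩ L`, so would `L′`. A common vertex of `K` and `L` would then be the
      -- centre of a claw with leaves `a` in `K` outside `L`, `b` in `L` outside `L′`, and `c` in
      -- `L′` outside `L`.
      no-third-beyond : ∀ {K L L′ M} → Adj T K L → Adj T L L′ → L′ ≢ K →
                        Star (Avoiding (Adj T) (_≡ L)) L′ M → ¬ Contains K L M
      no-third-beyond {K} {L} {L′} {M} KL LL′ L′≢K w K∩L⊆M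
        with common-vertex G-conn KL | outside-vertex (T-irr KL) | outside-vertex (T-irr LL′) | outside-vertex (T-irr LL′ ∘ sym)
      ... | v , v∈K , v∈L | a , a∈K , a∉L | b , b∈L , b∉L′ | c , c∈L′ , c∉L =
        no-claw {G = G} claw-free
          (adj-in K v∈K a∈K (λ { refl → a∉L v∈L }))
          (adj-in L v∈L b∈L (λ { refl → b∉L′ (K∩L⊆L′ v v∈K v∈L) }))
          (adj-in L′ (K∩L⊆L′ v v∈K v∈L) c∈L′ (λ { refl → c∉L v∈L }))
          (apart-across KL a∈K a∉L (inj₁ λ b∈K → b∉L′ (K∩L⊆L′ b b∈K b∈L)) b∈L ε)
          (apart-across LL′ b∈L b∉L′ (inj₁ c∉L) c∈L′ ε)
          (apart-across KL a∈K a∉L (inj₂ c∉L) c∈L′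
            ((LL′ , (λ { (L≡K , _) → T-irr KL (sym L≡K) }) , λ { (_ , L′≡K) → L′≢K L′≡K }) ◅ ε))
        where
        K∩L⊆L′ : Contains K L L′
        K∩L⊆L′ v v∈K v∈L = first-step-contains LL′ w v v∈L (K∩L⊆M v v∈K v∈L)

    -- A third clique lies beyond `L` as seen from `K`, or beyond `K` as seen from `L`: if the walk
    -- last leaves `L` through `K`, its last exit from `K` is used with the roles exchanged.
    adjacent⇒close : ∀ {K L} → Adj T K L → Close K L
    adjacent⇒close {K} {L} KL = T-irr KL , no-third
      where
      no-third : ¬ Third K L
      no-third (M , K∩L⊆M , M≢K , M≢L) with last-exit (_≟ᶜ L) (tree-walk L M) M≢L
      ... | inj₁ (_ , L≢L) = L≢L refl
      ... | inj₂ (_ , L′ , refl , LL′ , _ , w) with L′ ≟ᶜ K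
      ...   | no L′≢K = no-third-beyond KL LL′ L′≢K w K∩L⊆M
      ...   | yes refl with last-exit (_≟ᶜ K) w M≢K
      ...     | inj₁ (_ , K≢K) = K≢K refl
      ...     | inj₂ (_ , K′ , refl , (KK′ , _ , K′≢L) , _ , w′) =
        no-third-beyond (symAdj T KL) KK′ K′≢L (Star.map (λ { ((e , _) , x≢K , y≢K) → e , x≢K , y≢K }) w′)
          (λ v v∈L v∈K → K∩L⊆M v v∈K v∈L)

-- Chordless paths in chordal graphs

module _ {V : Set} {G : Graph V} (chordal : Chordal G) where

  -- With `s` the path closes to an induced cycle of length `r + 2`, which is at least four.
  no-hole : ∀ {r} {p : Fin (suc r) → V} {s} → 2 ≤ r → IsTrail (Adj G) p → Chordless (Adj G) p → (∀ i → s ≢ p i) →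
            Adj G s (p zero) → Adj G s (p (fromℕ r)) → ¬ (∀ i → i ≢ zero → i ≢ fromℕ r → ¬ Adj G s (p i))
  no-hole {r} {p} {s} 2≤r t c s∉p sp₀ spᵣ nonadjacent =
    chordal _ (s≤s (s≤s 2≤r)) (s ∷ p , cons-injective s∉p (inj t) , λ i j → mk⇔
      (cycle-edges {E = Adj G} (symAdj G) {s ∷ p} (ℕ.<⇒≤ (s≤s (s≤s 2≤r)))
        (λ { zero → sp₀ ; (suc i) → steps t i }) (symAdj G spᵣ) i j)
      (from i j))
    where
    spoke : ∀ j → Adj G s (p j) → SymClosure (CyclicSuc (suc (suc r))) zero (suc j)
    spoke j spⱼ with j Fin.≟ zero | j Fin.≟ fromℕ r
    ... | yes refl | _ = fwd (inj₁ refl)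
    ... | _ | yes refl = bwd (inj₂ (cong (λ m → suc (suc m)) (Fin.toℕ-fromℕ r) , refl))
    ... | no j≢0 | no j≢r = ⊥-elim (nonadjacent j j≢0 j≢r spⱼ)
    from : ∀ i j → Adj G ((s ∷ p) i) ((s ∷ p) j) → SymClosure (CyclicSuc (suc (suc r))) i j
    from zero zero e = ⊥-elim (irrAdj G refl e)
    from zero (suc j) e = spoke j e
    from (suc i) zero e = symmetric _ (spoke i (symAdj G e))
    from (suc i) (suc j) e with ℕ.<-cmp (toℕ i) (toℕ j)
    ... | tri≈ _ i≡j _ = ⊥-elim (irrAdj G (cong p (Fin.toℕ-injective i≡j)) e)
    ... | tri< i<j _ _ with ℕ.m≤n⇒m<n∨m≡n i<j
    ...   | inj₁ i+1<j = ⊥-elim (c i+1<j e)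
    ...   | inj₂ i+1≡j = fwd (inj₁ (cong suc i+1≡j))
    from (suc i) (suc j) e | tri> _ _ j<i with ℕ.m≤n⇒m<n∨m≡n j<i
    ...   | inj₁ j+1<i = ⊥-elim (c j+1<i (symAdj G e))
    ...   | inj₂ j+1≡i = bwd (inj₁ (cong suc j+1≡i))

  -- Cut the path at the last neighbour of `s` before its end. Were this not the second last vertex,
  -- the remaining path and `s` would form a hole.
  adjacent-to-second-last : ∀ {r} {p : Fin (suc (suc r)) → V} {s} → IsTrail (Adj G) p → Chordless (Adj G) p →
                            (∀ i → s ≢ p i) → (∃ λ i → Adj G s (p (inject₁ i))) → Adj G s (p (fromℕ (suc r))) →
                            Adj G s (p (inject₁ (fromℕ r)))
  adjacent-to-second-last {r} {p} {s} t c s∉p near s-last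
    with Fin.any? (λ j → adj? G s (p (inject₁ (suc j))))
  adjacent-to-second-last {suc r} t c s∉p near s-last | yes later =
    adjacent-to-second-last (tail-trail t) (c ∘ s≤s) (s∉p ∘ suc) later s-last
  adjacent-to-second-last t c s∉p (suc j , spⱼ) s-last | no ¬later = ⊥-elim (¬later (j , spⱼ))
  adjacent-to-second-last {zero} t c s∉p (zero , sp₀) s-last | no ¬later = sp₀
  adjacent-to-second-last {suc r} {p} {s} t c s∉p (zero , sp₀) s-last | no ¬later =
    ⊥-elim (no-hole (s≤s (s≤s z≤n)) t c s∉p sp₀ s-last nonadjacent)
    where
    nonadjacent : ∀ i → i ≢ zero → i ≢ fromℕ (suc (suc r)) → ¬ Adj G s (p i)
    nonadjacent i i≢0 i≢last with view i
    ... | ‵fromℕ = ⊥-elim (i≢last refl)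
    ... | ‵inject₁ zero = ⊥-elim (i≢0 refl)
    ... | ‵inject₁ (suc j) = λ spᵢ → ¬later (j , spᵢ)

-- Existence: the close graph is a clique tree

module CloseGraph {n : ℕ} (G : Graph (Fin n)) where

  open MaximalCliques G

  Shared : MaximalClique G → MaximalClique G → Pred (Fin n) 0ℓ
  Shared K L x = x ∈ᶜ K × x ∈ᶜ L

  shared? : ∀ K L x → Dec (Shared K L x)
  shared? K L x = (x ∈ᶜ? K) ×-dec (x ∈ᶜ? L)

  shared-clique : (K L : MaximalClique G) → IsClique G (value K ∩ value L)
  shared-clique K L u v u∈ v∈ u≢v = adj-in K (proj₁ (x∈p∩q⁻ _ _ u∈)) (proj₁ (x∈p∩q⁻ _ _ v∈)) u≢v

  -- Connectedness of the subtrees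

  module _ (claw-free : ClawFree G) where

    private
      module _ (K L : MaximalClique G) {v : Fin n} (v∈S : Shared K L v) where

        Linked : MaximalClique G → MaximalClique G → Set
        Linked X Y = ∃ λ x → ∃ λ y → (x ∈ᶜ X × ¬ Shared K L x) × (y ∈ᶜ Y × ¬ Shared K L y) × (x ≡ y ⊎ Adj G x y)

        linked-sym : ∀ {X Y} → Linked X Y → Linked Y X
        linked-sym (x , y , x∈ , y∈ , near) =
          y , x , y∈ , x∈ , [ (λ x≡y → inj₁ (sym x≡y)) , (λ xy → inj₂ (symAdj G xy)) ]′ near

        -- Otherwise v would be the centre of a claw with leaves in A ∖ B, B ∖ A and D.
        linked-to-one : ∀ {A B D b} → Contains K L A → Contains K L B → Contains K L D → A ≢ B →
                        b ∈ᶜ D → ¬ Shared K L b → Linked D A ⊎ Linked D B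
        linked-to-one {A} {B} {D} {b} S⊆A S⊆B S⊆D A≢B b∈D b∉S with outside-vertex A≢B
        ... | a , a∈A , a∉B with apart-vertex {B} a∉B
        ...   | m , m∈B , a≢m , ¬am = decide (b Fin.≟ a) (adj? G b a) (b Fin.≟ m) (adj? G b m)
          where
          v∈ : ∀ {X} → Contains K L X → v ∈ᶜ X
          v∈ S⊆X = S⊆X v (proj₁ v∈S) (proj₂ v∈S)
          a∉S : ¬ Shared K L a
          a∉S (a∈K , a∈L) = a∉B (S⊆B a a∈K a∈L)
          m∉S : ¬ Shared K L m
          m∉S (m∈K , m∈L) = ¬am (adj-in A a∈A (S⊆A m m∈K m∈L) a≢m)
          centre : ∀ X {x} → Contains K L X → x ∈ᶜ X → ¬ Shared K L x → Adj G v x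
          centre X S⊆X x∈X x∉S = adj-in X (v∈ {X} S⊆X) x∈X λ { refl → x∉S v∈S }
          decide : Dec (b ≡ a) → Dec (Adj G b a) → Dec (b ≡ m) → Dec (Adj G b m) → Linked D A ⊎ Linked D B
          decide (yes b≡a) _ _ _ = inj₁ (b , a , (b∈D , b∉S) , (a∈A , a∉S) , inj₁ b≡a)
          decide _ (yes ba) _ _ = inj₁ (b , a , (b∈D , b∉S) , (a∈A , a∉S) , inj₂ ba)
          decide _ _ (yes b≡m) _ = inj₂ (b , m , (b∈D , b∉S) , (m∈B , m∉S) , inj₁ b≡m)
          decide _ _ _ (yes bm) = inj₂ (b , m , (b∈D , b∉S) , (m∈B , m∉S) , inj₂ bm)
          decide (no b≢a) (no ¬ba) (no b≢m) (no ¬bm) = ⊥-elim (no-claw {G = G} claw-free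
            (centre A S⊆A a∈A a∉S) (centre B S⊆B m∈B m∉S) (centre D S⊆D b∈D b∉S)
            (a≢m , ¬am) (b≢m ∘ sym , ¬bm ∘ symAdj G) (b≢a ∘ sym , ¬ba ∘ symAdj G))

        -- Apply `linked-to-one` to a vertex of `L` outside `K` with the choice `K` or `M`, and to a
        -- vertex of `K` outside `L` with the choice `L` or `M`. Either `K` and `L` are linked, or
        -- both are linked to `M`.
        linked-via-third : K ≢ L → ∀ {M} → Contains K L M → M ≢ K → M ≢ L → Linked K L ⊎ (Linked K M × Linked M L)
        linked-via-third K≢L {M} S⊆M M≢K M≢L with outside-vertex K≢L | outside-vertex (K≢L ∘ sym)
        ... | a , a∈K , a∉L | b , b∈L , b∉K
          with linked-to-one {K} {M} {L} S⊆K S⊆M S⊆L (M≢K ∘ sym) b∈L (b∉K ∘ proj₁)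
             | linked-to-one {L} {M} {K} S⊆L S⊆M S⊆K (M≢L ∘ sym) a∈K (a∉L ∘ proj₂)
          where
          S⊆K : Contains K L K
          S⊆K _ x∈K _ = x∈K
          S⊆L : Contains K L L
          S⊆L _ _ x∈L = x∈L
        ... | inj₁ LK | _ = inj₁ (linked-sym {L} {K} LK)
        ... | _ | inj₁ KL = inj₁ KL
        ... | inj₂ LM | inj₂ KM = inj₂ (KM , linked-sym {L} {M} LM)

        -- Adjacent `x` and `y` lie with `S` in a clique `Z`. Both `X ∩ Z` and `Z ∩ Y` properly
        -- contain `S`, so the argument `walk` may be an induction hypothesis.
        linked-walk : {R : Rel (MaximalClique G) 0ℓ} →
          (∀ X Y → Contains K L X → Contains K L Y → ∀ x → Shared X Y x → ¬ Shared K L x → Star R X Y) →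
          ∀ X Y → Contains K L X → Contains K L Y → Linked X Y → Star R X Y
        linked-walk walk X Y S⊆X S⊆Y (x , y , (x∈X , x∉S) , (y∈Y , _) , inj₁ refl) = walk X Y S⊆X S⊆Y x (x∈X , y∈Y) x∉S
        linked-walk walk X Y S⊆X S⊆Y (x , y , (x∈X , x∉S) , (y∈Y , y∉S) , inj₂ xy)
          with edge-clique-over (shared-clique K L)
                 (λ s s∈ x≢s → let s∈K , s∈L = x∈p∩q⁻ _ _ s∈ in adj-in X x∈X (S⊆X s s∈K s∈L) x≢s)
                 (λ s s∈ y≢s → let s∈K , s∈L = x∈p∩q⁻ _ _ s∈ in adj-in Y y∈Y (S⊆Y s s∈K s∈L) y≢s) xy
        ... | Z , S⊆Z′ , x∈Z , y∈Z = walk X Z S⊆X S⊆Z x (x∈X , x∈Z) x∉S ◅◅ walk Z Y S⊆Z S⊆Y y (y∈Z , y∈Y) y∉S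
          where
          S⊆Z : Contains K L Z
          S⊆Z s s∈K s∈L = S⊆Z′ s (x∈p∩q⁺ (s∈K , s∈L))

    -- Induction on `K ∩ L`, larger intersections first: a pair that is not close has a third
    -- clique, and links replace the pair by pairs with larger intersections.
    subtree-walk : ∀ v {K L} → v ∈ᶜ K → v ∈ᶜ L → Star (edge (cliqueSubtree G closeGraph v)) K L
    subtree-walk v {K} {L} v∈K v∈L = go K L (⊃-wellFounded _) v∈K v∈L
      where
      R : Rel (MaximalClique G) 0ℓ
      R = edge (cliqueSubtree G closeGraph v)
      go : ∀ K L → Acc _⊃_ (value K ∩ value L) → v ∈ᶜ K → v ∈ᶜ L → Star R K L
      go K L (acc larger) v∈K v∈L with K ≟ᶜ L | third? K L
      ... | yes refl | _ = ε
      ... | no K≢L | no ¬third = (v∈K , v∈L , K≢L , ¬third) ◅ ε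
      ... | no K≢L | yes (M , S⊆M , M≢K , M≢L) =
        [ connect K L S⊆K S⊆L
        , (λ { (KM , ML) → connect K M S⊆K S⊆M KM ◅◅ connect M L S⊆M S⊆L ML })
        ]′ (linked-via-third K L (v∈K , v∈L) K≢L {M} S⊆M M≢K M≢L)
        where
        S⊆K : Contains K L K
        S⊆K _ x∈K _ = x∈K
        S⊆L : Contains K L L
        S⊆L _ _ x∈L = x∈L
        recurse : ∀ X Y → Contains K L X → Contains K L Y → ∀ x → Shared X Y x → ¬ Shared K L x → Star R X Y
        recurse X Y S⊆X S⊆Y x x∈ x∉S = go X Y
          (larger ( (λ {s} s∈ → let s∈K , s∈L = x∈p∩q⁻ _ _ s∈ in x∈p∩q⁺ (S⊆X s s∈K s∈L , S⊆Y s s∈K s∈L))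
                  , x , x∈p∩q⁺ x∈ , x∉S ∘ x∈p∩q⁻ _ _))
          (S⊆X v v∈K v∈L) (S⊆Y v v∈K v∈L)
        connect : ∀ X Y → Contains K L X → Contains K L Y → Linked K L (v∈K , v∈L) X Y → Star R X Y
        connect = linked-walk K L (v∈K , v∈L) recurse

  -- Acyclicity of the close graph

  module _ (chordal : Chordal G) where

    private
      module _ (K L : MaximalClique G) where

        -- Stopping at the first vertex of `K` keeps the source of every step outside `K`, while the
        -- final vertex lies in `K`.
        first-entry : ∀ {b a} → Star (Avoiding (Adj G) (Shared K L)) b a → ¬ Shared K L b → a ∈ᶜ K →
          ∃ λ a′ → a′ ∈ᶜ K × ¬ Shared K L a′ × Star (λ x y → Adj G x y × x ∉ᶜ K × ¬ Shared K L y) b a′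
        first-entry {b} w b∉S a∈K with b ∈ᶜ? K
        first-entry w b∉S a∈K | yes b∈K = _ , b∈K , b∉S , ε
        first-entry ε b∉S a∈K | no b∉K = ⊥-elim (b∉K a∈K)
        first-entry ((xy , _ , y∉S) ◅ w) b∉S a∈K | no b∉K with first-entry w y∉S a∈K
        ... | a′ , a′∈K , a′∉S , w′ = a′ , a′∈K , a′∉S , (xy , b∉K , y∉S) ◅ w′

        module _ {r : ℕ} {p : Fin (suc (suc r)) → Fin n}
                 (t : IsTrail (λ x y → Adj G x y × x ∉ᶜ K × ¬ Shared K L y) p)
                 (c : Chordless (λ x y → Adj G x y × x ∉ᶜ K × ¬ Shared K L y) p)
                 (start∈L : p zero ∈ᶜ L) (end∈K : p (fromℕ (suc r)) ∈ᶜ K) where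

          avoids : ∀ i → ¬ Shared K L (p i)
          avoids zero    = proj₁ (proj₂ (steps t zero)) ∘ proj₁
          avoids (suc i) = proj₂ (proj₂ (steps t i))

          -- The start of a forward chord is not the last vertex, so the side conditions hold for it
          -- and the chord is one of the restricted relation.
          G-chordless : Chordless (Adj G) p
          G-chordless {i} {j} i+1<j e with view i
          ... | ‵inject₁ k = c i+1<j (e , proj₁ (proj₂ (steps t k)) , avoids j)
          ... | ‵fromℕ = ℕ.<-irrefl refl (ℕ.<-≤-trans
            (ℕ.<-trans (ℕ.n<1+n _) (subst (λ m → suc m < toℕ j) (Fin.toℕ-fromℕ (suc r)) i+1<j)) (Fin.toℕ≤pred[n] j))

          -- `s` is adjacent to the start inside `L` and to the end inside `K`.
          shared-adjacent : ∀ s → Shared K L s → Adj G (p (inject₁ (fromℕ r))) s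
          shared-adjacent s (s∈K , s∈L) = symAdj G (adjacent-to-second-last {G = G} chordal
            (record { steps = proj₁ ∘ steps t ; inj = inj t }) G-chordless s≢p
            (zero , adj-in L s∈L start∈L (s≢p zero)) (adj-in K s∈K end∈K (s≢p _)))
            where
            s≢p : ∀ i → s ≢ p i
            s≢p i refl = avoids i (s∈K , s∈L)

          -- Extend `S` together with the last edge to a maximal clique. It is not `K`, as the
          -- second last vertex is outside `K`; it is not `L`, as the last vertex is in `K` but not
          -- in `S`.
          path⇒third : Third K L
          path⇒third
            with edge-clique-over (shared-clique K L)
                   (λ s s∈ _ → shared-adjacent s (x∈p∩q⁻ _ _ s∈))
                   (λ s s∈ y≢s → adj-in K end∈K (proj₁ (x∈p∩q⁻ _ _ s∈)) y≢s)
                   (proj₁ (steps t (fromℕ r)))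
          ... | M , S⊆M , x∈M , y∈M =
            M , (λ s s∈K s∈L → S⊆M s (x∈p∩q⁺ (s∈K , s∈L)))
              , (λ { refl → proj₁ (proj₂ (steps t (fromℕ r))) x∈M })
              , (λ { refl → avoids (fromℕ (suc r)) (end∈K , y∈M) })

        walk⇒third : ∀ {b a} → Star (Avoiding (Adj G) (Shared K L)) b a → b ∈ᶜ L → b ∉ᶜ K → a ∈ᶜ K → Third K L
        walk⇒third w b∈L b∉K a∈K with first-entry w (b∉K ∘ proj₁) a∈K
        ... | a′ , a′∈K , a′∉S , w′ with walk⇒chordlessPath Fin._≟_
               (λ x y → adj? G x y ×-dec (¬? (x ∈ᶜ? K) ×-dec ¬? (shared? K L y))) w′
        ...   | chordlessPath {length = zero} t c refl refl = ⊥-elim (b∉K a′∈K)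
        ...   | chordlessPath {length = suc r} t c refl refl = path⇒third t c b∈L a′∈K

    -- Around a cycle K₀ K₁ … of close pairs, consecutive cliques share vertices outside
    -- S = K₀ ∩ K₁, so G - S joins K₁ ∖ S to K₀ ∖ S, and a third clique contains S.
    closeGraph-acyclic : Acyclic (whole closeGraph)
    closeGraph-acyclic (suc (suc (suc m))) (s≤s (s≤s (s≤s z≤n))) (f , f-inj , f-edge) = no-cycle
      where
      K₀ K₁ : MaximalClique G
      K₀ = f zero
      K₁ = f (suc zero)
      close : ∀ i j → Adj (cycleGraph (suc (suc (suc m))) (s≤s (s≤s (s≤s z≤n)))) i j → Close (f i) (f j)
      close i j e = proj₂ (proj₂ (f-edge i j e))
      escape : ∀ {X Y Z} → Close X Y → Z ≢ X → Z ≢ Y → ∃ λ x → Shared X Y x × x ∉ᶜ Z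
      escape {X} {Y} {Z} (_ , ¬third) Z≢X Z≢Y =
        decidable-stable (Fin.any? λ x → shared? X Y x ×-dec ¬? (x ∈ᶜ? Z)) λ none →
          ¬third (Z , (λ x x∈X x∈Y → decidable-stable (x ∈ᶜ? Z) λ x∉Z → none (x , (x∈X , x∈Y) , x∉Z)) , Z≢X , Z≢Y)
      Walk : Rel (Fin n) 0ℓ
      Walk = Star (Avoiding (Adj G) (Shared K₀ K₁))
      hop : ∀ M {x y} → x ∈ᶜ M → y ∈ᶜ M → ¬ Shared K₀ K₁ x → ¬ Shared K₀ K₁ y → Walk x y
      hop M {x} {y} x∈M y∈M x∉S y∉S with x Fin.≟ y
      ... | yes refl = ε
      ... | no x≢y   = (adj-in M x∈M y∈M x≢y , x∉S , y∉S) ◅ ε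
      no-cycle : ⊥
      no-cycle with outside-vertex {K₁} {K₀} (λ K₁≡K₀ → Fin.0≢1+n (sym (f-inj K₁≡K₀)))
      ... | t , t∈K₁ , t∉K₀
        -- The last clique and `K₀` are close, so `K₁` omits a common vertex `u` of theirs: the
        -- target of the tour in `K₀`, outside `S`.
        with escape {f (fromℕ (suc (suc m)))} {K₀} {K₁}
               (close (fromℕ (suc (suc m))) zero (fwd (inj₂ (cong (λ l → suc (suc (suc l))) (Fin.toℕ-fromℕ m) , refl))))
               (λ e → Fin.0≢1+n (Fin.suc-injective (f-inj e))) (λ e → Fin.0≢1+n (sym (f-inj e)))
      ... | u , (u∈last , u∈K₀) , u∉K₁ =
        proj₂ (close zero (suc zero) (fwd (inj₁ refl)))
          (walk⇒third K₀ K₁ (tour (fromℕ (suc m)) u u∈last (u∉K₁ ∘ proj₂)) t∈K₁ t∉K₀ u∈K₀)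
        where
        tour : ∀ i x → x ∈ᶜ f (suc i) → ¬ Shared K₀ K₁ x → Walk t x
        tour = <-weakInduction (λ i → ∀ x → x ∈ᶜ f (suc i) → ¬ Shared K₀ K₁ x → Walk t x)
          (λ x x∈K₁ x∉S → hop K₁ t∈K₁ x∈K₁ (t∉K₀ ∘ proj₁) x∉S)
          next
          where
          next : ∀ i → (∀ x → x ∈ᶜ f (suc (inject₁ i)) → ¬ Shared K₀ K₁ x → Walk t x) →
                 ∀ x → x ∈ᶜ f (suc (suc i)) → ¬ Shared K₀ K₁ x → Walk t x
          next i ih x x∈ x∉S
            -- A common vertex outside `K₀` is outside `S`, so the tour may pass through it.
            with escape {f (suc (inject₁ i))} {f (suc (suc i))} {K₀}
                   (close (suc (inject₁ i)) (suc (suc i)) (fwd (inj₁ (cong (λ l → suc (suc l)) (Fin.toℕ-inject₁ i)))))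
                   (λ e → Fin.0≢1+n (f-inj e)) (λ e → Fin.0≢1+n (f-inj e))
          ... | u , (u∈ , u∈′) , u∉K₀ = ih u u∈ (u∉K₀ ∘ proj₁) ◅◅ hop (f (suc (suc i))) u∈′ x∈ (u∉K₀ ∘ proj₁) x∉S

  closeGraph-isCliqueTree : ConnectedGraph G → ClawFree G → Chordal G → IsCliqueTree G closeGraph
  closeGraph-isCliqueTree G-conn claw-free chordal =
    (((proj₁ (vertex-clique v₀) , tt) , connected) , acyclic) ,
    λ v → (vertex-clique v , λ _ _ v∈K v∈L → subtree-walk claw-free v v∈K v∈L) ,
          acyclic-subgraph acyclic (cliqueSubtree G closeGraph v)
    where
    v₀ : Fin n
    v₀ = proj₁ (proj₁ G-conn)
    acyclic : Acyclic (whole closeGraph)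
    acyclic = closeGraph-acyclic chordal
    connected : EmptyOrConnected (whole closeGraph)
    connected K L _ _ with clique-inhabited G-conn K | clique-inhabited G-conn L
    ... | a , a∈K | b , b∈L = clique-chain
      (λ v v∈K v∈L → Star.map (λ { (_ , _ , e) → tt , tt , e }) (subtree-walk claw-free v v∈K v∈L))
      (proj₂ G-conn a b tt tt) a∈K b∈L

theorem1 : ∀ {n : ℕ} (G : Graph (Fin n)) → ConnectedGraph G →
    ((ClawFree G × Chordal G) ⇔ IsNCPathTreeGraph G) ×
    (ClawFree G × Chordal G →
    ∃! _≈ᴳ_ (IsCliqueTree G) ×
    (∀ T → IsCliqueTree G T → IsNCPathTreeModel G T (cliqueSubtree G T)))
theorem1 {n} G G-conn = mk⇔ ncModel (λ { (_ , _ , _ , model , nc) →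
                          PathTreeModel.clawFree model nc , PathTreeModel.chordal model })
                      , λ { (claw-free , chordal) →
                          ( closeGraph
                          , closeGraph-isCliqueTree G-conn claw-free chordal
                          , λ {T} isCliqueTree K L → mk⇔ (close⇒adjacent {G = G} {T} isCliqueTree)
                                                     (adjacent⇒close {G = G} {T} isCliqueTree G-conn claw-free) )
                          , λ T isCliqueTree → CliqueTree.isNCPathTreeModel isCliqueTree claw-free G-conn }
  where
  open MaximalCliques G using (closeGraph)
  open CloseGraph G
  ncModel : ClawFree G × Chordal G → IsNCPathTreeGraph G
  ncModel (claw-free , chordal) = MaximalClique G , closeGraph , cliqueSubtree G closeGraph ,
    CliqueTree.isNCPathTreeModel (closeGraph-isCliqueTree G-conn claw-free chordal) claw-free G-conn
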